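{- The following iterative rounding algorithm can be implemented to run in polynomial time. Input: a graph $G=(V,E)$ with vertex costs $c:V\to\mathbb{R}_{\ge0}$. Initialize $H_0=G$, $R_0=\emptyset$, $i=0$. While $H_i$ contains a cycle: let $x^{(i)}$ be the vector returned by the subroutine Produce-Witness on $(H_i,c)$, let $A_i=\{u\in V(H_i):x^{(i)}_u\ge 1/2\}$, set $R_{i+1}=R_i\cup A_i$ and $H_{i+1}=H_i-A_i$, and increment $i$. Return $R_i$.
   Context: Graphs are finite, undirected, simple and loopless. For $S\subseteq V$, $E[S]$ is the edge set of the induced subgraph $G[S]$ and $d_S(u)$ the degree of $u$ in $G[S]$. The strong density polyhedron is $$P_{SD}(G)=\Big\{x\in[0,1]^V:\ \sum_{u\in S}(d_S(u)-1)x_u\ge |E[S]|-|S|+1\quad\text{for all } S\subseteq V \text{ with } E[S]\neq\emptyset\Big\}.$$ Produce-Witness is a polynomial-time subroutine that, given a graph $H=(W,F)$ containing a cycle and non-negative vertex costs $c$, returns a vector $x^*\in\mathbb{R}^W_{\ge0}$ such that (i) $c^Tx^*\le\min\{c^Tx:x\in P_{SD}(H)\}$; (ii) there exists $u\in W$ with $x^*_u\ge1/2$; (iii) for $A=\{u\in W:x^*_u\ge1/2\}$, the restriction of $x^*$ to $W\setminus A$ lies in $P_{SD}(H-A)$. For running time statements, costs are rational and time is measured in the encoding length of the input. -}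

module Defs where

open import Level using (0ℓ)
open import Data.Bool using (Bool; true; false)
open import Data.Nat as ℕ using (ℕ; suc; _*_; _^_; _≤_)
open import Data.Nat.Binary using (ℕᵇ; zero; 2[1+_]; 1+[2_]; fromℕ)
open import Data.Integer as ℤ using (ℤ; +_; -[1+_])
open import Data.Rational as ℚ using (ℚ; 0ℚ; 1ℚ; ½)
open import Data.Fin as Fin using (Fin)
open import Data.Fin.Subset using (Subset; _∈_; _∉_; _⊆_; _∩_; _∪_; _─_; ∣_∣)
open import Data.Fin.Subset.Properties using (_∈?_; x∈p∧x∉q⇒x∈p─q)
open import Data.List using (List; []; _∷_; _∷ʳ_; length; map; filter; foldr; allFin; cartesianProduct)
open import Data.List.Relation.Unary.Linked using (Linked)
open import Data.List.Relation.Unary.Unique.Propositional using (Unique)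
open import Data.Product using (_×_; _,_; ∃₂; ∃-syntax)
open import Data.Vec using (tabulate)
open import Relation.Binary using (Rel; Decidable; Symmetric; Irreflexive)
open import Relation.Binary.PropositionalEquality using (_≡_; _≢_)
open import Relation.Nullary using (¬_; does; ¬?; _×-dec_)

-- A finite simple graph whose vertices carry labels from Fin n.  The
-- vertex set V may be a proper subset of Fin n, so that vertices keep
-- their names when other vertices are deleted.
record Graph (n : ℕ) : Set₁ where
  infix 4 _~_ _~?_
  field
    V        : Subset n
    _~_      : Rel (Fin n) 0ℓ
    _~?_     : Decidable _~_
    ~-sym    : Symmetric _~_
    ~-irrefl : Irreflexive _≡_ _~_
    ~⇒∈V     : ∀ {u v} → u ~ v → u ∈ V

private variable
  n : ℕ

infixl 6 _∖_

_∖_ : Graph n → Subset n → Graph n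
G ∖ A = record
  { V        = V ─ A
  ; _~_      = λ u v → u ~ v × u ∉ A × v ∉ A
  ; _~?_     = λ u v → (u ~? v) ×-dec ¬? (u ∈? A) ×-dec ¬? (v ∈? A)
  ; ~-sym    = λ (e , u∉A , v∉A) → ~-sym e , v∉A , u∉A
  ; ~-irrefl = λ eq (e , _) → ~-irrefl eq e
  ; ~⇒∈V     = λ (e , u∉A , _) → x∈p∧x∉q⇒x∈p─q (~⇒∈V e) u∉A
  } where open Graph G

HasCycle : Graph n → Set
HasCycle {n} G = ∃₂ λ (u : Fin n) (vs : List (Fin n)) →
  Unique (u ∷ vs) × 3 ≤ length (u ∷ vs) × Linked _~_ ((u ∷ vs) ∷ʳ u)
  where open Graph G

-- The members of a subset, in increasing order.
elements : Subset n → List (Fin n)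
elements {n} S = filter (_∈? S) (allFin n)

∑ : Subset n → (Fin n → ℚ) → ℚ
∑ S f = foldr ℚ._+_ 0ℚ (map f (elements S))

degree : Graph n → Subset n → Fin n → ℕ
degree G S u = ∣ S ∩ tabulate (λ v → does (u ~? v)) ∣
  where open Graph G

-- E[S], each edge listed once as a pair (u , v) with u < v.
edges : Graph n → Subset n → List (Fin n × Fin n)
edges G S = filter (λ (u , v) → (u Fin.<? v) ×-dec (u ~? v))
                   (cartesianProduct (elements S) (elements S))
  where open Graph G

fromℤ : ℤ → ℚ
fromℤ z = z ℚ./ 1

-- A function Fin n → ℚ stands for a vector indexed by V G: its values
-- outside V G are never inspected, so restricting it to fewer vertices
-- leaves the function itself unchanged.
_∈P-SD_ : (Fin n → ℚ) → Graph n → Set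
_∈P-SD_ {n} x G =
  (∀ u → u ∈ V → 0ℚ ℚ.≤ x u × x u ℚ.≤ 1ℚ) ×
  (∀ (S : Subset n) → S ⊆ V → edges G S ≢ [] →
     ∑ S (λ u → fromℤ (+ degree G S u ℤ.- + 1) ℚ.* x u)
       ℚ.≥ fromℤ (+ length (edges G S) ℤ.- + ∣ S ∣ ℤ.+ + 1))
  where open Graph G

NonNegative : Graph n → (Fin n → ℚ) → Set
NonNegative G x = ∀ u → u ∈ Graph.V G → 0ℚ ℚ.≤ x u

cost : Graph n → (c x : Fin n → ℚ) → ℚ
cost G c x = ∑ (Graph.V G) (λ u → c u ℚ.* x u)

large : Graph n → (Fin n → ℚ) → Subset n
large G x = tabulate (λ u → does ((u ∈? V) ×-dec (½ ℚ.≤? x u)))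
  where open Graph G

record IsWitness {n} (H : Graph n) (c x : Fin n → ℚ) : Set where
  open Graph H
  field
    nonneg   : NonNegative H x
    optimal  : ∀ y → y ∈P-SD H → cost H c x ℚ.≤ cost H c y
    has-half : ∃[ u ] u ∈ V × ½ ℚ.≤ x u
    residual : x ∈P-SD (H ∖ large H x)

-- WHILE-programs over binary trees (as in N. D. Jones, "Computability
-- and Complexity from a Programming Perspective"), written without
-- variables: a program transforms a single tree, which holds its whole
-- memory.
data Tree : Set where
  nil : Tree
  _∙_ : Tree → Tree → Tree

infixr 5 _∙_

size : Tree → ℕ
size nil     = 1
size (a ∙ b) = suc (size a ℕ.+ size b)

infixr 4 _⨾_

data Prog : Set where
  id nil hd tl  : Prog
  _⨾_           : Prog → Prog → Prog
  ⟨_,_⟩         : Prog → Prog → Prog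
  if_then_else_ : Prog → Prog → Prog → Prog
  while_loop_   : Prog → Prog → Prog

-- p ⊢ v ⇓ w ⟨ t ⟩ : program p on input v halts with output w in time t.
--
-- Every step is charged the size of the tree it acts on.  Under unit
-- cost, iterated pairing would build exponentially large trees in
-- linear time; here the size of an output never exceeds the running
-- time, and time agrees with Turing machine time up to a polynomial.
infix 3 _⊢_⇓_⟨_⟩

data _⊢_⇓_⟨_⟩ : Prog → Tree → Tree → ℕ → Set where
  id : ∀ {v} → id ⊢ v ⇓ v ⟨ size v ⟩

  nil : ∀ {v} → nil ⊢ v ⇓ nil ⟨ size v ⟩

  hd-∙   : ∀ {a b} → hd ⊢ a ∙ b ⇓ a ⟨ size (a ∙ b) ⟩
  hd-nil : hd ⊢ nil ⇓ nil ⟨ size nil ⟩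

  tl-∙   : ∀ {a b} → tl ⊢ a ∙ b ⇓ b ⟨ size (a ∙ b) ⟩
  tl-nil : tl ⊢ nil ⇓ nil ⟨ size nil ⟩

  seq : ∀ {p q v w z s t} →
    p ⊢ v ⇓ w ⟨ s ⟩ → q ⊢ w ⇓ z ⟨ t ⟩ →
    (p ⨾ q) ⊢ v ⇓ z ⟨ s ℕ.+ t ⟩

  pair : ∀ {p q v a b s t} →
    p ⊢ v ⇓ a ⟨ s ⟩ → q ⊢ v ⇓ b ⟨ t ⟩ →
    ⟨ p , q ⟩ ⊢ v ⇓ a ∙ b ⟨ size v ℕ.+ s ℕ.+ t ⟩

  if-true : ∀ {e p q v a b w s t} →
    e ⊢ v ⇓ a ∙ b ⟨ s ⟩ → p ⊢ v ⇓ w ⟨ t ⟩ →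
    (if e then p else q) ⊢ v ⇓ w ⟨ size v ℕ.+ s ℕ.+ t ⟩

  if-false : ∀ {e p q v w s t} →
    e ⊢ v ⇓ nil ⟨ s ⟩ → q ⊢ v ⇓ w ⟨ t ⟩ →
    (if e then p else q) ⊢ v ⇓ w ⟨ size v ℕ.+ s ℕ.+ t ⟩

  while-true : ∀ {e p v a b w z r s t} →
    e ⊢ v ⇓ a ∙ b ⟨ r ⟩ → p ⊢ v ⇓ w ⟨ s ⟩ →
    (while e loop p) ⊢ w ⇓ z ⟨ t ⟩ →
    (while e loop p) ⊢ v ⇓ z ⟨ size v ℕ.+ r ℕ.+ s ℕ.+ t ⟩

  while-false : ∀ {e p v r} →
    e ⊢ v ⇓ nil ⟨ r ⟩ →
    (while e loop p) ⊢ v ⇓ v ⟨ size v ℕ.+ r ⟩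

encodeBool : Bool → Tree
encodeBool false = nil
encodeBool true  = nil ∙ nil

encodeList : {A : Set} → (A → Tree) → List A → Tree
encodeList f []       = nil
encodeList f (x ∷ xs) = f x ∙ encodeList f xs

encodeℕᵇ : ℕᵇ → Tree
encodeℕᵇ zero     = nil
encodeℕᵇ 2[1+ b ] = nil ∙ encodeℕᵇ b
encodeℕᵇ 1+[2 b ] = (nil ∙ nil) ∙ encodeℕᵇ b

encodeℕ : ℕ → Tree
encodeℕ m = encodeℕᵇ (fromℕ m)

encodeℤ : ℤ → Tree
encodeℤ (+ m)    = encodeBool false ∙ encodeℕ m
encodeℤ -[1+ m ] = encodeBool true  ∙ encodeℕ (suc m)

encodeℚ : ℚ → Tree
encodeℚ q = encodeℤ (ℚ.↥ q) ∙ encodeℕ (ℚ.↧ₙ q)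

-- The adjacency matrix indexed by V; labels outside V leave no trace.
encodeGraph : Graph n → Tree
encodeGraph G =
  encodeList (λ u → encodeList (λ v → encodeBool (does (u ~? v))) (elements V))
             (elements V)
  where open Graph G

encodeVector : Graph n → (Fin n → ℚ) → Tree
encodeVector G x = encodeList (λ u → encodeℚ (x u)) (elements (Graph.V G))

encodeSubset : Graph n → Subset n → Tree
encodeSubset G R = encodeList (λ u → encodeBool (does (u ∈? R))) (elements (Graph.V G))

encodeInput : Graph n → (Fin n → ℚ) → Tree
encodeInput G c = encodeGraph G ∙ encodeVector G c

Returns : Prog → (H : Graph n) (c x : Fin n → ℚ) → Set
Returns pw H c x = ∃[ t ] pw ⊢ encodeInput H c ⇓ encodeVector H x ⟨ t ⟩

-- Sizes are at least 1, so bounds a * sizeᵏ cover all polynomial bounds.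
IsProduceWitness : Prog → Set₁
IsProduceWitness pw = ∃₂ λ (a k : ℕ) →
  ∀ {n} (H : Graph n) (c : Fin n → ℚ) → NonNegative H c → HasCycle H →
  ∃₂ λ (x : Fin n → ℚ) (t : ℕ) →
    pw ⊢ encodeInput H c ⇓ encodeVector H x ⟨ t ⟩ ×
    t ≤ a * size (encodeInput H c) ^ k ×
    IsWitness H c x

-- Rounding pw c H R R′ : the loop, entered with Hᵢ = H and Rᵢ = R,
-- terminates and returns R′.
data Rounding (pw : Prog) {n} (c : Fin n → ℚ) : Graph n → Subset n → Subset n → Set₁ where
  stop : ∀ {H R} → ¬ HasCycle H → Rounding pw c H R R
  step : ∀ {H R R′} (x : Fin n → ℚ) →
    HasCycle H → Returns pw H c x →
    Rounding pw c (H ∖ large H x) (R ∪ large H x) R′ →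
    Rounding pw c H R R′

module Submission where

-- The loop keeps only the characteristic vector of Rᵢ over V(G) and recomputes
-- the encoding of Hᵢ = G − Rᵢ in every round.  By (ii) a round removes a vertex,
-- so |V| rounds suffice, and the input of each call of Produce-Witness is no
-- larger than a polynomial in the original input, however large its previous
-- outputs were.  To test for a cycle, vertices with at most one unpruned
-- neighbour are pruned simultaneously, |V| times: no vertex of a cycle is ever
-- pruned, and if some vertex survives then all survivors have two surviving
-- neighbours, so a path among them can be continued until it closes a cycle.

open import Defs
open import Data.Bool using (Bool; true; false; not; _∧_; _∨_; T)
  renaming (if_then_else_ to when_then_else_)
open import Data.Bool.Properties using (T-≡)
open import Data.Fin using (Fin; zero; suc)
open import Data.Fin.Properties using (_≟_; injective⇒≤)
open import Data.Fin.Subset as Subset using (Subset; ⊥; _∪_; _─_; inside; outside)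
open import Data.Fin.Subset.Properties
  using (_∈?_; ∉⊥; p─⊥≡p; p─q⊆p; p─q─r≡p─q∪r; x∈p∪q⁺; x∈p∪q⁻; x∈p∧x∉q⇒x∈p─q)
open import Data.Integer using (+_; -[1+_])
open import Data.List
  using (List; []; _∷_; _∷ʳ_; allFin; filter; filterᵇ; length; lookup; null; take)
import Data.List.Membership.DecPropositional as DecMembership
open import Data.List.Membership.Propositional using (_∈_; _∉_)
open import Data.List.Membership.Propositional.Properties
  using (∈-++⁺ˡ; ∈-++⁻; ∈-allFin; ∈-filter⁺; ∈-filter⁻; ∈-length; ∈-lookup)
open import Data.List.Properties using (filter-notAll; length-filter)
open import Data.List.Relation.Unary.All as All using ([]; _∷_)
open import Data.List.Relation.Unary.All.Properties using (¬Any⇒All¬)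
open import Data.List.Relation.Unary.AllPairs using ([]; _∷_)
open import Data.List.Relation.Unary.Any as Any using (here; there)
open import Data.List.Relation.Unary.Linked using (Linked; [-]; _∷_)
open import Data.List.Relation.Unary.Unique.Propositional using (Unique)
import Data.List.Relation.Unary.Unique.Propositional.Properties as Unique
open import Data.Nat
  using (ℕ; zero; suc; _+_; _*_; _^_; _≤_; _<_; _<ᵇ_; z≤n; s≤s; s≤s⁻¹)
open import Data.Nat.Binary using (zero; 2[1+_]; 1+[2_]; fromℕ; toℕ)
open import Data.Nat.Binary.Properties using (toℕ-fromℕ)
open import Data.Nat.Properties hiding (_≟_; ≡-irrelevant)
open import Data.Nat.Tactic.RingSolver using (solve-∀)
open import Data.Product using (_×_; _,_; Σ-syntax; map₂; proj₁; proj₂)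
open import Data.Rational as ℚ using (ℚ; mkℚ; ½)
open import Data.Sum using (_⊎_; inj₁; inj₂)
open import Data.Vec using (_∷_; here; there)
open import Data.Vec.Properties using (lookup∘tabulate; lookup⇒[]=; []=⇒lookup)
open import Function using (_∘_)
open import Function.Bundles using (Equivalence; mk⇔)
open import Level using (Level; 0ℓ)
open import Relation.Binary using (Rel; Symmetric)
open import Relation.Binary.PropositionalEquality
  using (_≡_; _≢_; refl; sym; trans; cong; cong₂; subst)
open import Relation.Binary.PropositionalEquality.WithK using (≡-irrelevant)
open import Relation.Nullary
  using (¬_; Dec; ¬?; contradiction; does; no; yes; _×-dec_; _⊎-dec_)
open import Relation.Nullary.Decidable using (T?; dec-false; dec-true; does-⇔)

-- A `Polytime` value ties a program to two encodings of one semantic index, so graphs, stages of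
-- the rounding and proofs can be the data of an iteration although the program sees only a tree.
-- Preconditions live in the index: the specification of Produce-Witness covers cyclic graphs only,
-- and the cycle test puts the required evidence into the index of the branch that makes the call.
-- The only loop built here is a fold over a list fixed in advance. Pruning and rounding are both
-- such folds, counted by a list with one entry per vertex. The obstacle is that a polynomial-time
-- step, iterated polynomially often, need not stay polynomial; masks avoid this because their size
-- is controlled by the number of vertices alone.

private variable
  ℓ ℓ′ : Level
  n : ℕ
  A : Set
  I : Set ℓ
  J : Set ℓ′
  inp mid out o₁ o₂ : I → Tree

-- Polynomial-time programs

-- Bounds stay symbolic because the form `a * n ^ k` is not literally closed under sums or
-- composition. Natural coefficients make every polynomial monotone.
data Polynomial : Set where
  con     : ℕ → Polynomial
  X       : Polynomial
  _⊕_ _⊗_ : Polynomial → Polynomial → Polynomial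

infixl 6 _⊕_
infixl 7 _⊗_
infixl 8 _⊙_

⟦_⟧ : Polynomial → ℕ → ℕ
⟦ con c ⟧ n = c
⟦ X ⟧     n = n
⟦ p ⊕ q ⟧ n = ⟦ p ⟧ n + ⟦ q ⟧ n
⟦ p ⊗ q ⟧ n = ⟦ p ⟧ n * ⟦ q ⟧ n

_⊙_ : Polynomial → Polynomial → Polynomial
con c   ⊙ r = con c
X       ⊙ r = r
(p ⊕ q) ⊙ r = (p ⊙ r) ⊕ (q ⊙ r)
(p ⊗ q) ⊙ r = (p ⊙ r) ⊗ (q ⊙ r)

⟦⊙⟧ : ∀ p r n → ⟦ p ⊙ r ⟧ n ≡ ⟦ p ⟧ (⟦ r ⟧ n)
⟦⊙⟧ (con c) r n = refl
⟦⊙⟧ X       r n = refl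
⟦⊙⟧ (p ⊕ q) r n = cong₂ _+_ (⟦⊙⟧ p r n) (⟦⊙⟧ q r n)
⟦⊙⟧ (p ⊗ q) r n = cong₂ _*_ (⟦⊙⟧ p r n) (⟦⊙⟧ q r n)

⟦⟧-mono : ∀ p {m n} → m ≤ n → ⟦ p ⟧ m ≤ ⟦ p ⟧ n
⟦⟧-mono (con c) m≤n = ≤-refl
⟦⟧-mono X       m≤n = m≤n
⟦⟧-mono (p ⊕ q) m≤n = +-mono-≤ (⟦⟧-mono p m≤n) (⟦⟧-mono q m≤n)
⟦⟧-mono (p ⊗ q) m≤n = *-mono-≤ (⟦⟧-mono p m≤n) (⟦⟧-mono q m≤n)

⟦⊙⟧-bound : ∀ p r {m n} → m ≤ ⟦ r ⟧ n → ⟦ p ⟧ m ≤ ⟦ p ⊙ r ⟧ n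
⟦⊙⟧-bound p r {n = n} m≤ = ≤-trans (⟦⟧-mono p m≤) (≤-reflexive (sym (⟦⊙⟧ p r n)))

X^ : ℕ → Polynomial
X^ zero    = con 1
X^ (suc k) = X ⊗ X^ k

⟦X^⟧ : ∀ k n → ⟦ X^ k ⟧ n ≡ n ^ k
⟦X^⟧ zero    n = refl
⟦X^⟧ (suc k) n = cong (n *_) (⟦X^⟧ k n)

-- For a sum, `1 ≤ n` allows both exponents to be raised to `k + l`.
monomial-bound : ∀ p → Σ[ a ∈ ℕ ] Σ[ k ∈ ℕ ] (∀ n → 1 ≤ n → ⟦ p ⟧ n ≤ a * n ^ k)
monomial-bound (con c) = c , 0 , λ n _ → ≤-reflexive (sym (*-identityʳ c))
monomial-bound X       = 1 , 1 , λ n _ →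
  ≤-reflexive (sym (trans (*-identityˡ (n ^ 1)) (^-identityʳ n)))
monomial-bound (p ⊕ q) with monomial-bound p | monomial-bound q
... | a , k , p≤ | b , l , q≤ = a + b , k + l , bound
  where
  open ≤-Reasoning
  bound : ∀ n → 1 ≤ n → ⟦ p ⟧ n + ⟦ q ⟧ n ≤ (a + b) * n ^ (k + l)
  bound n@(suc _) 1≤n = begin
    ⟦ p ⟧ n + ⟦ q ⟧ n
      ≤⟨ +-mono-≤ (p≤ n 1≤n) (q≤ n 1≤n) ⟩
    a * n ^ k + b * n ^ l
      ≤⟨ +-mono-≤ (*-monoʳ-≤ a (^-monoʳ-≤ n (m≤m+n k l)))
                  (*-monoʳ-≤ b (^-monoʳ-≤ n (m≤n+m l k))) ⟩
    a * n ^ (k + l) + b * n ^ (k + l)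
      ≡⟨ *-distribʳ-+ (n ^ (k + l)) a b ⟨
    (a + b) * n ^ (k + l) ∎
monomial-bound (p ⊗ q) with monomial-bound p | monomial-bound q
... | a , k , p≤ | b , l , q≤ = a * b , k + l , bound
  where
  open ≤-Reasoning
  interchange : ∀ a b c d → (a * b) * (c * d) ≡ (a * c) * (b * d)
  interchange = solve-∀
  bound : ∀ n → 1 ≤ n → ⟦ p ⟧ n * ⟦ q ⟧ n ≤ (a * b) * n ^ (k + l)
  bound n 1≤n = begin
    ⟦ p ⟧ n * ⟦ q ⟧ n             ≤⟨ *-mono-≤ (p≤ n 1≤n) (q≤ n 1≤n) ⟩
    (a * n ^ k) * (b * n ^ l)     ≡⟨ interchange a (n ^ k) b (n ^ l) ⟩
    (a * b) * (n ^ k * n ^ l)     ≡⟨ cong (a * b *_) (^-distribˡ-+-* n k l) ⟨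
    (a * b) * n ^ (k + l)         ∎

1≤size : ∀ v → 1 ≤ size v
1≤size nil     = ≤-refl
1≤size (a ∙ b) = s≤s z≤n

size-hd≤ : ∀ a b → size a ≤ size (a ∙ b)
size-hd≤ a b = m≤n⇒m≤1+n (m≤m+n (size a) (size b))

size-tl≤ : ∀ a b → size b ≤ size (a ∙ b)
size-tl≤ a b = m≤n⇒m≤1+n (m≤n+m (size b) (size a))

-- Charging by tree size pays off here: a time bound for one program bounds the input of the next,
-- so running times compose.
output-size≤time : ∀ {p v w t} → p ⊢ v ⇓ w ⟨ t ⟩ → size w ≤ t
output-size≤time id                = ≤-refl
output-size≤time {v = v} nil       = 1≤size v
output-size≤time (hd-∙ {a} {b})    = size-hd≤ a b
output-size≤time hd-nil            = ≤-refl
output-size≤time (tl-∙ {a} {b})    = size-tl≤ a b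
output-size≤time tl-nil            = ≤-refl
output-size≤time (seq {s = s} {t} d e) = ≤-trans (output-size≤time e) (m≤n+m t s)
output-size≤time {v = v} (pair d e) =
  +-mono-≤ (+-mono-≤ (1≤size v) (output-size≤time d)) (output-size≤time e)
output-size≤time (if-true {t = t} d e)  = ≤-trans (output-size≤time e) (m≤n+m t _)
output-size≤time (if-false {t = t} d e) = ≤-trans (output-size≤time e) (m≤n+m t _)
output-size≤time (while-true {t = t} d e f) = ≤-trans (output-size≤time f) (m≤n+m t _)
output-size≤time (while-false d)    = m≤m+n _ _

infix 3 _⊢_⇓_within_

_⊢_⇓_within_ : Prog → Tree → Tree → ℕ → Set
p ⊢ v ⇓ w within N = Σ[ t ∈ ℕ ] (p ⊢ v ⇓ w ⟨ t ⟩ × t ≤ N)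

-- The index set may express a precondition on the inputs.
record Polytime {I : Set ℓ} (inp out : I → Tree) : Set ℓ where
  constructor polytime
  field
    program : Prog
    bound   : Polynomial
    run     : ∀ i → program ⊢ inp i ⇓ out i within ⟦ bound ⟧ (size (inp i))

  out-size : ∀ i → size (out i) ≤ ⟦ bound ⟧ (size (inp i))
  out-size i with run i
  ... | t , d , t≤ = ≤-trans (output-size≤time d) t≤

open Polytime

castᴾ : (∀ i → out i ≡ o₁ i) → Polytime inp out → Polytime inp o₁
castᴾ {inp = inp} eq P = polytime (program P) (bound P) λ i →
  subst (λ w → program P ⊢ inp i ⇓ w within ⟦ bound P ⟧ (size (inp i))) (eq i) (run P i)

reindex : (r : J → I) → Polytime inp out → Polytime (inp ∘ r) (out ∘ r)
reindex r P = polytime (program P) (bound P) (run P ∘ r)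

varᴾ : Polytime inp inp
varᴾ = polytime id X λ i → _ , id , ≤-refl

nilᴾ : Polytime inp (λ _ → nil)
nilᴾ = polytime nil X λ i → _ , nil , ≤-refl

seqᴾ : Polytime inp mid → Polytime mid out → Polytime inp out
seqᴾ P Q = polytime (program P ⨾ program Q) (bound P ⊕ bound Q ⊙ bound P) λ i →
  let (_ , d , s≤) = run P i
      (_ , e , t≤) = run Q i
  in _ , seq d e ,
     +-mono-≤ s≤ (≤-trans t≤ (⟦⊙⟧-bound (bound Q) (bound P) (out-size P i)))

infixr 5 _∙ᴾ_

_∙ᴾ_ : Polytime inp o₁ → Polytime inp o₂ → Polytime inp (λ i → o₁ i ∙ o₂ i)
P ∙ᴾ Q = polytime ⟨ program P , program Q ⟩ (X ⊕ bound P ⊕ bound Q) λ i →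
  let (_ , d , s≤) = run P i
      (_ , e , t≤) = run Q i
  in _ , pair d e , +-mono-≤ (+-monoʳ-≤ _ s≤) t≤

head tail : Tree → Tree
head nil     = nil
head (a ∙ b) = a
tail nil     = nil
tail (a ∙ b) = b

headᴾ : Polytime inp out → Polytime inp (head ∘ out)
headᴾ P = seqᴾ P (reindex _ (polytime {inp = λ v → v} {out = head} hd X
  λ { nil → _ , hd-nil , ≤-refl ; (a ∙ b) → _ , hd-∙ , ≤-refl }))

tailᴾ : Polytime inp out → Polytime inp (tail ∘ out)
tailᴾ P = seqᴾ P (reindex _ (polytime {inp = λ v → v} {out = tail} tl X
  λ { nil → _ , tl-nil , ≤-refl ; (a ∙ b) → _ , tl-∙ , ≤-refl }))

isCons : Tree → Bool
isCons nil     = false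
isCons (_ ∙ _) = true

-- Each branch must be right only on the inputs that reach it, and the outcome of the test is part
-- of its index. This makes a call with a precondition possible.
branchᴾ : {c : I → Tree} (b : I → Bool) → (∀ i → isCons (c i) ≡ b i) → Polytime inp c →
  Polytime {I = Σ[ i ∈ I ] b i ≡ true} (inp ∘ proj₁) (out ∘ proj₁) →
  Polytime {I = Σ[ i ∈ I ] b i ≡ false} (inp ∘ proj₁) (out ∘ proj₁) →
  Polytime inp out
branchᴾ {inp = inp} {out = out} {c = c} b c≡b C P Q =
  polytime (if program C then program P else program Q) (X ⊕ bound C ⊕ (bound P ⊕ bound Q)) go
  where
  go : ∀ i → (if program C then program P else program Q) ⊢ inp i ⇓ out i within _
  go i with c i | c≡b i | run C i
  ... | nil   | false≡b | (_ , d , s≤) =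
    let (_ , e , t≤) = run Q (i , sym false≡b)
    in _ , if-false d e , +-mono-≤ (+-monoʳ-≤ _ s≤) (≤-trans t≤ (m≤n+m _ _))
  ... | _ ∙ _ | true≡b  | (_ , d , s≤) =
    let (_ , e , t≤) = run P (i , sym true≡b)
    in _ , if-true d e , +-mono-≤ (+-monoʳ-≤ _ s≤) (≤-trans t≤ (m≤m+n _ _))

ifᴾ : {c : I → Tree} → Polytime inp c → Polytime inp o₁ → Polytime inp o₂ →
  Polytime inp (λ i → when isCons (c i) then o₁ i else o₂ i)
ifᴾ {o₁ = o₁} {o₂ = o₂} {c = c} C P Q = branchᴾ (isCons ∘ c) (λ _ → refl) C
  (castᴾ (λ (i , eq) → sym (cong (when_then o₁ i else o₂ i) eq)) (reindex proj₁ P))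
  (castᴾ (λ (i , eq) → sym (cong (when_then o₁ i else o₂ i) eq)) (reindex proj₁ Q))

-- A tree is also the list of the heads along its right spine.
foldTree : {S : Set ℓ} → (Tree → S → S) → S → Tree → S
foldTree f s nil     = s
foldTree f s (x ∙ l) = foldTree f (f x s) l

spine : Tree → ℕ
spine nil     = 0
spine (x ∙ l) = suc (spine l)

spine≤size : ∀ l → spine l ≤ size l
spine≤size nil     = z≤n
spine≤size (x ∙ l) = s≤s (≤-trans (spine≤size l) (m≤n+m (size l) (size x)))

-- Since a step enlarges the state by an amount that does not depend on the
-- state, all states of the fold have polynomial size.
module Fold {I : Set ℓ} {S : I → Set ℓ′} {c : I → Tree} (enc : ∀ i → S i → Tree)
  (f : ∀ i → Tree → S i → S i)
  (growth : Polynomial)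
  (grow : ∀ i x s → size (enc i (f i x s)) ≤ size (enc i s) + ⟦ growth ⟧ (size (c i ∙ x)))
  (Step : Polytime {I = Σ[ i ∈ I ] (Tree × S i)}
            (λ (i , x , s) → c i ∙ x ∙ enc i s) (λ (i , x , s) → enc i (f i x s)))
  where

  private
    State : Set _
    State = Σ[ i ∈ I ] (Tree × S i)

    state : State → Tree
    state (i , l , s) = c i ∙ l ∙ enc i s

    Cond : Polytime state (λ (i , l , s) → l)
    Cond = headᴾ (tailᴾ varᴾ)

    Body : Polytime {I = Σ[ i ∈ I ] (Tree × Tree × S i)}
      (λ (i , x , l , s) → state (i , x ∙ l , s)) (λ (i , x , l , s) → state (i , l , f i x s))
    Body = headᴾ varᴾ ∙ᴾ tailᴾ (headᴾ (tailᴾ varᴾ)) ∙ᴾ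
      seqᴾ (headᴾ varᴾ ∙ᴾ headᴾ (headᴾ (tailᴾ varᴾ)) ∙ᴾ tailᴾ (tailᴾ varᴾ))
           (reindex (λ (i , x , l , s) → i , x , s) Step)

    loop : Prog
    loop = while program Cond loop program Body

    perStep : ℕ → ℕ
    perStep K = K + ⟦ bound Cond ⟧ K + ⟦ bound Body ⟧ K

    shift : ∀ c l s g e → c + (l + (s + g)) + e ≡ c + (l + s) + (g + e)
    shift = solve-∀

    -- `N` bounds every item, and `K` bounds the current state together with the growth still to
    -- come. That sum never rises along the loop, so `perStep K` covers every iteration; `suc` pays
    -- for the final failing test.
    loop-run : ∀ i N K l s → size l ≤ N →
      size (state (i , l , s)) + spine l * ⟦ growth ⟧ (suc (size (c i) + N)) ≤ K →
      loop ⊢ state (i , l , s) ⇓ state (i , nil , foldTree (f i) s l)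
        within (suc (spine l) * perStep K)
    loop-run i N K nil s l≤ v≤ =
      let v≤K          = m+n≤o⇒m≤o (size (state (i , nil , s))) v≤
          (_ , d , r≤) = run Cond (i , nil , s)
      in _ , while-false d ,
         ≤-trans (+-mono-≤ v≤K (≤-trans r≤ (⟦⟧-mono (bound Cond) v≤K)))
                 (≤-trans (m≤m+n _ _) (m≤m+n _ 0))
    loop-run i N K (x ∙ l) s l≤ v≤ =
      let v≤K          = m+n≤o⇒m≤o (size (state (i , x ∙ l , s))) v≤
          (_ , d , r≤) = run Cond (i , x ∙ l , s)
          (_ , e , s≤) = run Body (i , x , l , s)
          (_ , h , t≤) = loop-run i N K l (f i x s) (≤-trans (size-tl≤ x l) l≤) smaller
      in _ , while-true d e h ,
         +-mono-≤ (+-mono-≤ (+-mono-≤ v≤K (≤-trans r≤ (⟦⟧-mono (bound Cond) v≤K)))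
                            (≤-trans s≤ (⟦⟧-mono (bound Body) v≤K))) t≤
      where
      open ≤-Reasoning
      g = ⟦ growth ⟧ (suc (size (c i) + N))
      smaller : size (state (i , l , f i x s)) + spine l * g ≤ K
      smaller = begin
        suc (size (c i) + suc (size l + size (enc i (f i x s)))) + spine l * g
          ≤⟨ +-monoˡ-≤ (spine l * g) (s≤s (+-monoʳ-≤ (size (c i)) (s≤s (+-monoʳ-≤ (size l)
              (≤-trans (grow i x s) (+-monoʳ-≤ (size (enc i s)) (⟦⟧-mono growth
                (s≤s (+-monoʳ-≤ (size (c i)) (≤-trans (size-hd≤ x l) l≤)))))))))) ⟩
        suc (size (c i) + (suc (size l) + (size (enc i s) + g))) + spine l * g
          ≡⟨ cong suc (shift (size (c i)) (suc (size l)) (size (enc i s)) g (spine l * g)) ⟩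
        suc (size (c i) + (suc (size l) + size (enc i s))) + (g + spine l * g)
          ≤⟨ +-monoˡ-≤ (g + spine l * g) (s≤s (+-monoʳ-≤ (size (c i)) (s≤s
              (+-monoˡ-≤ (size (enc i s)) (size-tl≤ x l))))) ⟩
        suc (size (c i) + suc (size (x ∙ l) + size (enc i s))) + (g + spine l * g)
          ≤⟨ v≤ ⟩
        K ∎

    -- The initial state plus one growth per item: the number of items and the argument of `growth`
    -- are both at most the size of the initial state.
    stateBound : Polynomial
    stateBound = X ⊕ X ⊗ growth

    Loop : Polytime state (λ (i , l , s) → state (i , nil , foldTree (f i) s l))
    Loop = polytime loop
      ((con 1 ⊕ X) ⊗ (stateBound ⊕ bound Cond ⊙ stateBound ⊕ bound Body ⊙ stateBound))
      λ (i , l , s) →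
      let v       = state (i , l , s)
          n       = size v
          K       = ⟦ stateBound ⟧ n
          l≤      = ≤-trans (size-hd≤ l (enc i s)) (size-tl≤ (c i) (l ∙ enc i s))
          spine≤  = ≤-trans (spine≤size l) l≤
          c∙l≤    = s≤s (+-monoʳ-≤ (size (c i)) (m≤n⇒m≤1+n (m≤m+n (size l) (size (enc i s)))))
          (t , d , t≤) = loop-run i (size l) K l s ≤-refl
            (+-monoʳ-≤ n (*-mono-≤ spine≤ (⟦⟧-mono growth c∙l≤)))
      in t , d , ≤-trans t≤ (*-mono-≤ (s≤s spine≤)
           (+-mono-≤ (+-monoʳ-≤ K (≤-reflexive (sym (⟦⊙⟧ (bound Cond) stateBound n))))
                     (≤-reflexive (sym (⟦⊙⟧ (bound Body) stateBound n)))))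

  foldᴾ : {inp l : I → Tree} {s : ∀ i → S i} →
    Polytime inp c → Polytime inp l → Polytime inp (λ i → enc i (s i)) →
    Polytime inp (λ i → enc i (foldTree (f i) (s i) (l i)))
  foldᴾ {l = l} {s} C L E =
    tailᴾ (tailᴾ (seqᴾ (C ∙ᴾ L ∙ᴾ E) (reindex (λ i → i , l i , s i) Loop)))

-- Boolean connectives and list operations as programs

isCons-encodeBool : ∀ b → isCons (encodeBool b) ≡ b
isCons-encodeBool false = refl
isCons-encodeBool true  = refl

size-encodeBool≤3 : ∀ b → size (encodeBool b) ≤ 3
size-encodeBool≤3 false = s≤s z≤n
size-encodeBool≤3 true  = ≤-refl

isConsᴾ : {t : I → Tree} → Polytime inp t → Polytime inp (encodeBool ∘ isCons ∘ t)
isConsᴾ {t = t} P = castᴾ (λ i → eq (isCons (t i))) (ifᴾ P (nilᴾ ∙ᴾ nilᴾ) nilᴾ)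
  where
  eq : ∀ b → (when b then nil ∙ nil else nil) ≡ encodeBool b
  eq false = refl
  eq true  = refl

whenᴾ : {b : I → Bool} → Polytime inp (encodeBool ∘ b) → Polytime inp o₁ → Polytime inp o₂ →
  Polytime inp (λ i → when b i then o₁ i else o₂ i)
whenᴾ {o₁ = o₁} {o₂ = o₂} {b = b} B P Q =
  castᴾ (λ i → cong (when_then o₁ i else o₂ i) (isCons-encodeBool (b i))) (ifᴾ B P Q)

notᴾ : {b : I → Bool} → Polytime inp (encodeBool ∘ b) →
  Polytime inp (λ i → encodeBool (not (b i)))
notᴾ {b = b} P = castᴾ (λ i → eq (b i)) (whenᴾ P nilᴾ (nilᴾ ∙ᴾ nilᴾ))
  where
  eq : ∀ b → (when b then nil else nil ∙ nil) ≡ encodeBool (not b)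
  eq false = refl
  eq true  = refl

module _ {a b : I → Bool} where

  infixr 6 _∧ᴾ_
  infixr 5 _∨ᴾ_

  _∧ᴾ_ : Polytime inp (encodeBool ∘ a) → Polytime inp (encodeBool ∘ b) →
    Polytime inp (λ i → encodeBool (a i ∧ b i))
  P ∧ᴾ Q = castᴾ (λ i → eq (a i)) (whenᴾ P Q nilᴾ)
    where
    eq : ∀ c {d} → (when c then encodeBool d else nil) ≡ encodeBool (c ∧ d)
    eq false = refl
    eq true  = refl

  _∨ᴾ_ : Polytime inp (encodeBool ∘ a) → Polytime inp (encodeBool ∘ b) →
    Polytime inp (λ i → encodeBool (a i ∨ b i))
  P ∨ᴾ Q = castᴾ (λ i → eq (a i)) (whenᴾ P (nilᴾ ∙ᴾ nilᴾ) Q)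
    where
    eq : ∀ c {d} → (when c then nil ∙ nil else encodeBool d) ≡ encodeBool (c ∨ d)
    eq false = refl
    eq true  = refl

-- A left fold can only build its result back to front.
reverseTree : Tree → Tree
reverseTree = foldTree _∙_ nil

reverseᴾ : {l : I → Tree} → Polytime inp l → Polytime inp (reverseTree ∘ l)
reverseᴾ {I = I} L = foldᴾ nilᴾ L nilᴾ
  where
  open Fold {I = I} {c = λ _ → nil} (λ _ s → s) (λ _ → _∙_) X
    (λ i x s → ≤-trans (≤-reflexive (+-comm (suc (size x)) (size s)))
                       (+-monoʳ-≤ (size s) (n≤1+n (suc (size x)))))
    (tailᴾ varᴾ)

gather : (Tree → Bool) → (Tree → Tree) → Tree → Tree
gather p g nil     = nil
gather p g (x ∙ l) = when p x then g x ∙ gather p g l else gather p g l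

module _ (p : Tree → Bool) (g : Tree → Tree) where

  gatherStep : Tree → Tree → Tree
  gatherStep x s = when p x then g x ∙ s else s

  reverse-gatherStep : ∀ l s →
    reverseTree (foldTree gatherStep s l) ≡ foldTree _∙_ (gather p g l) s
  reverse-gatherStep nil     s = refl
  reverse-gatherStep (x ∙ l) s with p x
  ... | false = reverse-gatherStep l s
  ... | true  = reverse-gatherStep l (g x ∙ s)

  gather-encodeList : {q : A → Bool} {e e′ : A → Tree} →
    (∀ x → p (e x) ≡ q x) → (∀ x → g (e x) ≡ e′ x) →
    ∀ xs → gather p g (encodeList e xs) ≡ encodeList e′ (filterᵇ q xs)
  gather-encodeList p≡q g≡e′ [] = refl
  gather-encodeList {q = q} {e} p≡q g≡e′ (x ∷ xs) with p (e x) | q x | p≡q x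
  ... | false | false | refl = gather-encodeList p≡q g≡e′ xs
  ... | true  | true  | refl = cong₂ _∙_ (g≡e′ x) (gather-encodeList p≡q g≡e′ xs)

-- `p` and `g` see the context `c i` besides the item; masks are passed to them this way. Both are
-- total on trees, and their effect on encodings is settled separately by `gather-encodeList`.
gatherᴾ : {c l : I → Tree} {p : I → Tree → Bool} {g : I → Tree → Tree} →
  Polytime inp c →
  Polytime {I = I × Tree} (λ (i , x) → c i ∙ x) (λ (i , x) → encodeBool (p i x)) →
  Polytime {I = I × Tree} (λ (i , x) → c i ∙ x) (λ (i , x) → g i x) →
  Polytime inp l → Polytime inp (λ i → gather (p i) (g i) (l i))
gatherᴾ {I = I} {c = c} {l} {p} {g} C P G L =
  castᴾ (λ i → reverse-gatherStep (p i) (g i) (l i) nil) (reverseᴾ (foldᴾ C L nilᴾ))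
  where
  grow : ∀ i x s → size (gatherStep (p i) (g i) x s) ≤
    size s + suc (⟦ Polytime.bound G ⟧ (size (c i ∙ x)))
  grow i x s with p i x
  ... | false = m≤m+n (size s) _
  ... | true  = ≤-trans (≤-reflexive (+-comm (suc (size (g i x))) (size s)))
                        (+-monoʳ-≤ (size s) (s≤s (Polytime.out-size G (i , x))))
  item : {o : I × Tree → Tree} → Polytime (λ (i , x) → c i ∙ x) o →
    Polytime {I = I × Tree × Tree} (λ (i , x , s) → c i ∙ x ∙ s) (λ (i , x , s) → o (i , x))
  item Q = seqᴾ (headᴾ varᴾ ∙ᴾ headᴾ (tailᴾ varᴾ)) (reindex (λ (i , x , s) → i , x) Q)
  open Fold {I = I} {c = c} (λ _ s → s) (λ i → gatherStep (p i) (g i))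
    (con 1 ⊕ Polytime.bound G) grow
    (whenᴾ (item P) (item G ∙ᴾ tailᴾ (tailᴾ varᴾ)) (tailᴾ (tailᴾ varᴾ)))

-- Equality holds at `nil`, whose head and tail are both `nil`. Moving an entry from one list of a
-- state to another thus costs only a constant, as a growth bound independent of the state demands.
size-head+tail≤ : ∀ t → size (head t) + size (tail t) ≤ suc (size t)
size-head+tail≤ nil     = ≤-refl
size-head+tail≤ (a ∙ b) = ≤-trans (n≤1+n _) (n≤1+n _)

size-tail≤ : ∀ t → size (tail t) ≤ size t
size-tail≤ nil     = ≤-refl
size-tail≤ (a ∙ b) = size-tl≤ a b

zipStep : Tree → Tree × Tree → Tree × Tree
zipStep x (m , acc) = tail m , (x ∙ head m) ∙ acc

zipTree : Tree → Tree → Tree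
zipTree l m = reverseTree (proj₂ (foldTree zipStep (m , nil) l))

zipTree-encodeList : (f g : A → Tree) (xs : List A) →
  zipTree (encodeList f xs) (encodeList g xs) ≡ encodeList (λ x → f x ∙ g x) xs
zipTree-encodeList f g = go nil
  where
  go : ∀ acc xs →
    reverseTree (proj₂ (foldTree zipStep (encodeList g xs , acc) (encodeList f xs))) ≡
    foldTree _∙_ (encodeList (λ x → f x ∙ g x) xs) acc
  go acc []       = refl
  go acc (x ∷ xs) = go ((f x ∙ g x) ∙ acc) xs

zipᴾ : {l m : I → Tree} → Polytime inp l → Polytime inp m →
  Polytime inp (λ i → zipTree (l i) (m i))
zipᴾ {I = I} L M = reverseᴾ (tailᴾ (foldᴾ nilᴾ L (M ∙ᴾ nilᴾ)))
  where
  arrange : ∀ h t x a → suc (t + suc (suc (x + h) + a)) ≡ h + t + suc (suc (suc (x + a)))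
  arrange = solve-∀
  arrange′ : ∀ m x a → suc m + suc (suc (suc (x + a))) ≡ suc (m + a) + suc (suc (suc x))
  arrange′ = solve-∀
  grow : ∀ (i : I) x ((m , acc) : Tree × Tree) →
    size (tail m ∙ (x ∙ head m) ∙ acc) ≤ size (m ∙ acc) + suc (size (nil ∙ x))
  grow i x (m , acc) = ≤-trans
    (≤-reflexive (arrange (size (head m)) (size (tail m)) (size x) (size acc)))
    (≤-trans (+-monoˡ-≤ _ (size-head+tail≤ m))
             (≤-reflexive (arrange′ (size m) (size x) (size acc))))
  open Fold {I = I} {c = λ _ → nil} (λ _ (m , acc) → m ∙ acc) (λ _ → zipStep) (con 1 ⊕ X) grow
    (tailᴾ (headᴾ (tailᴾ (tailᴾ varᴾ))) ∙ᴾ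
     (headᴾ (tailᴾ varᴾ) ∙ᴾ headᴾ (headᴾ (tailᴾ (tailᴾ varᴾ)))) ∙ᴾ
     tailᴾ (tailᴾ (tailᴾ varᴾ)))

-- This undoes the deletion of masked entries: a set bit is copied, and an unset bit is replaced by
-- the next entry of `m`, which lists the unmasked positions only. It carries bits over the
-- remaining vertices back to all vertices.
fillStep : Tree → Tree × Tree → Tree × Tree
fillStep x (m , acc) = when isCons x then (m , x ∙ acc) else (tail m , head m ∙ acc)

fill : Tree → Tree → Tree
fill l m = reverseTree (proj₂ (foldTree fillStep (m , nil) l))

fill-encodeList : (μ h : A → Bool) (xs : List A) →
  fill (encodeList (encodeBool ∘ μ) xs) (encodeList (encodeBool ∘ h) (filterᵇ (not ∘ μ) xs)) ≡
  encodeList (λ x → encodeBool (μ x ∨ h x)) xs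
fill-encodeList μ h = go nil
  where
  go : ∀ acc xs →
    reverseTree (proj₂ (foldTree fillStep
      (encodeList (encodeBool ∘ h) (filterᵇ (not ∘ μ) xs) , acc)
      (encodeList (encodeBool ∘ μ) xs))) ≡
    foldTree _∙_ (encodeList (λ x → encodeBool (μ x ∨ h x)) xs) acc
  go acc [] = refl
  go acc (x ∷ xs) with μ x
  ... | false = go (encodeBool (h x) ∙ acc) xs
  ... | true  = go ((nil ∙ nil) ∙ acc) xs

fillᴾ : {l m : I → Tree} → Polytime inp l → Polytime inp m →
  Polytime inp (λ i → fill (l i) (m i))
fillᴾ {I = I} L M = reverseᴾ (tailᴾ (foldᴾ nilᴾ L (M ∙ᴾ nilᴾ)))
  where
  enc : Tree × Tree → Tree
  enc (m , acc) = m ∙ acc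
  arrange : ∀ h t a → suc (t + suc (h + a)) ≡ h + t + suc (suc a)
  arrange = solve-∀
  arrange′ : ∀ m a → suc m + suc (suc a) ≡ suc (m + a) + 2
  arrange′ = solve-∀
  arrange″ : ∀ m x a → suc (m + suc (x + a)) ≡ suc (m + a) + suc x
  arrange″ = solve-∀
  grow : ∀ (i : I) x s → size (enc (fillStep x s)) ≤ size (enc s) + size (nil ∙ x)
  grow i nil (m , acc) = ≤-trans
    (≤-reflexive (arrange (size (head m)) (size (tail m)) (size acc)))
    (≤-trans (+-monoˡ-≤ _ (size-head+tail≤ m))
      (≤-trans (≤-reflexive (arrange′ (size m) (size acc)))
        (+-monoʳ-≤ (suc (size m + size acc)) (n≤1+n 2))))
  grow i x@(_ ∙ _) (m , acc) = ≤-trans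
    (≤-reflexive (arrange″ (size m) (size x) (size acc)))
    (+-monoʳ-≤ (suc (size m + size acc)) (n≤1+n (suc (size x))))
  push : ∀ x (s : Tree × Tree) → (when isCons x then proj₁ s ∙ x ∙ proj₂ s
    else tail (proj₁ s) ∙ head (proj₁ s) ∙ proj₂ s) ≡ enc (fillStep x s)
  push nil     s = refl
  push (_ ∙ _) s = refl
  open Fold {I = I} {c = λ _ → nil} (λ _ → enc) (λ _ → fillStep) X grow
    (castᴾ (λ (_ , x , s) → push x s)
      (ifᴾ (headᴾ (tailᴾ varᴾ))
        (headᴾ (tailᴾ (tailᴾ varᴾ)) ∙ᴾ headᴾ (tailᴾ varᴾ) ∙ᴾ tailᴾ (tailᴾ (tailᴾ varᴾ)))
        (tailᴾ (headᴾ (tailᴾ (tailᴾ varᴾ))) ∙ᴾ headᴾ (headᴾ (tailᴾ (tailᴾ varᴾ))) ∙ᴾ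
         tailᴾ (tailᴾ (tailᴾ varᴾ)))))

-- Binary numerals

-- Comparison x < y + r of binary numerals with digits 1 (encoded as true)
-- and 2 (encoded as false), least significant digit first, where r is a
-- carry: d + 2x < e + 2y + r iff x < y + [d < e + r].
carry : Bool → Bool → Bool → Bool
carry d e r = when r then d ∨ not e else (d ∧ not e)

-- Digits are never zero. A digit of `x` left over after `y` has ended forces `x ≥ 1`, so the
-- comparison fails with either carry. Once `x` has ended, `0 < y + r` holds iff a digit of `y` or
-- the carry remains.
compareStep : Tree → Tree × Bool → Tree × Bool
compareStep d (y , r) = tail y , isCons y ∧ carry (isCons d) (isCons (head y)) r

compareTree : Tree × Bool → Tree → Bool
compareTree s x = let (y , r) = foldTree compareStep s x in isCons y ∨ r

compareᴾ : {x y : I → Tree} → Polytime inp x → Polytime inp y →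
  Polytime inp (λ i → encodeBool (compareTree (y i , false) (x i)))
compareᴾ {I = I} {inp = inp} {x = x} {y} P Q =
  seqᴾ Run (isConsᴾ (headᴾ varᴾ) ∨ᴾ tailᴾ varᴾ)
  where
  grow : ∀ (i : I) d ((y , r) : Tree × Bool) →
    size (tail y ∙ encodeBool (proj₂ (compareStep d (y , r)))) ≤ size (y ∙ encodeBool r) + 3
  grow i d (y , r) = ≤-trans
    (s≤s (+-mono-≤ (size-tail≤ y) (size-encodeBool≤3 (proj₂ (compareStep d (y , r))))))
    (+-monoˡ-≤ 3 (s≤s (m≤m+n (size y) _)))
  Carry : {d e r : J → Bool} → Polytime mid (encodeBool ∘ d) → Polytime mid (encodeBool ∘ e) →
    Polytime mid (encodeBool ∘ r) → Polytime mid (λ i → encodeBool (carry (d i) (e i) (r i)))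
  Carry {d = d} {e} {r} D E R = castᴾ (λ i → eq (r i) {d i} {e i})
    (whenᴾ R (D ∨ᴾ notᴾ E) (D ∧ᴾ notᴾ E))
    where
    eq : ∀ r {d e} → (when r then encodeBool (d ∨ not e) else encodeBool (d ∧ not e)) ≡
      encodeBool (carry d e r)
    eq false = refl
    eq true  = refl
  open Fold {I = I} {c = λ _ → nil} (λ _ (y , r) → y ∙ encodeBool r) (λ _ → compareStep)
    (con 3) grow
    (tailᴾ (headᴾ (tailᴾ (tailᴾ varᴾ))) ∙ᴾ
      isConsᴾ (headᴾ (tailᴾ (tailᴾ varᴾ))) ∧ᴾ
      Carry (isConsᴾ (headᴾ (tailᴾ varᴾ))) (isConsᴾ (headᴾ (headᴾ (tailᴾ (tailᴾ varᴾ)))))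
        (tailᴾ (tailᴾ (tailᴾ varᴾ))))
  Run : Polytime inp (λ i → let (y′ , r) = foldTree compareStep (y i , false) (x i)
                            in y′ ∙ encodeBool r)
  Run = foldᴾ nilᴾ P (Q ∙ᴾ nilᴾ)


even<ᵇeven : ∀ x y → (2 * x <ᵇ 2 * y) ≡ (x <ᵇ y)
even<ᵇeven x y = does-⇔ (mk⇔ (*-cancelˡ-< 2 x y) (*-monoʳ-< 2)) (2 * x <? 2 * y) (x <? y)

even<ᵇodd : ∀ x y → (2 * x <ᵇ suc (2 * y)) ≡ (x <ᵇ suc y)
even<ᵇodd x y = does-⇔
  (mk⇔ (λ p → s≤s (*-cancelˡ-≤ 2 (s≤s⁻¹ p))) (λ p → s≤s (*-monoʳ-≤ 2 (s≤s⁻¹ p))))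
  (2 * x <? suc (2 * y)) (x <? suc y)

odd<ᵇeven : ∀ x y → (suc (2 * x) <ᵇ 2 * y) ≡ (x <ᵇ y)
odd<ᵇeven x y = does-⇔
  (mk⇔ (λ p → *-cancelˡ-< 2 x y (<-trans (n<1+n _) p))
       (λ p → ≤-trans (≤-reflexive (sym (*-suc 2 x))) (*-monoʳ-≤ 2 p)))
  (suc (2 * x) <? 2 * y) (x <? y)

toℕᵇ : Bool → ℕ
toℕᵇ false = 0
toℕᵇ true  = 1

private
  rearrange : ∀ a c {b b′ d d′} → b ≡ b′ → (a <ᵇ b′) ≡ (c <ᵇ d′) → d ≡ d′ → (a <ᵇ b) ≡ (c <ᵇ d)
  rearrange a c refl eq refl = eq

-- The suffix gives the least significant digits of the two numerals: `2 * suc x` ends in 2 and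
-- `suc (2 * x)` in 1. Each case absorbs the carry, which may flip the parity of the right side, and
-- then cancels the factor 2.
carry-correct-22 : ∀ x y r →
  (2 * suc x <ᵇ 2 * suc y + toℕᵇ r) ≡ (x <ᵇ y + toℕᵇ (carry false false r))
carry-correct-22 x y false =
  rearrange (2 * suc x) x (+-identityʳ (2 * suc y)) (even<ᵇeven (suc x) (suc y)) (+-identityʳ y)
carry-correct-22 x y true =
  rearrange (2 * suc x) x (+-comm (2 * suc y) 1) (even<ᵇodd (suc x) (suc y)) (+-comm y 1)

carry-correct-21 : ∀ x y r →
  (2 * suc x <ᵇ suc (2 * y) + toℕᵇ r) ≡ (x <ᵇ y + toℕᵇ (carry false true r))
carry-correct-21 x y false =
  rearrange (2 * suc x) x (+-identityʳ (suc (2 * y))) (even<ᵇodd (suc x) y) (+-identityʳ y)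
carry-correct-21 x y true =
  rearrange (2 * suc x) x (trans (+-comm (suc (2 * y)) 1) (sym (*-suc 2 y)))
    (even<ᵇeven (suc x) (suc y)) (+-identityʳ y)

carry-correct-12 : ∀ x y r →
  (suc (2 * x) <ᵇ 2 * suc y + toℕᵇ r) ≡ (x <ᵇ y + toℕᵇ (carry true false r))
carry-correct-12 x y false =
  rearrange (suc (2 * x)) x (+-identityʳ (2 * suc y)) (odd<ᵇeven x (suc y)) (+-comm y 1)
carry-correct-12 x y true =
  rearrange (suc (2 * x)) x (+-comm (2 * suc y) 1) (even<ᵇeven x (suc y)) (+-comm y 1)

carry-correct-11 : ∀ x y r →
  (suc (2 * x) <ᵇ suc (2 * y) + toℕᵇ r) ≡ (x <ᵇ y + toℕᵇ (carry true true r))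
carry-correct-11 x y false =
  rearrange (suc (2 * x)) x (+-identityʳ (suc (2 * y))) (even<ᵇeven x y) (+-identityʳ y)
carry-correct-11 x y true =
  rearrange (suc (2 * x)) x (+-comm (suc (2 * y)) 1) (even<ᵇodd x y) (+-comm y 1)

compareTree-correct : ∀ x y r →
  compareTree (encodeℕᵇ y , r) (encodeℕᵇ x) ≡ (toℕ x <ᵇ toℕ y + toℕᵇ r)
compareTree-correct zero     zero     false = refl
compareTree-correct zero     zero     true  = refl
compareTree-correct zero     2[1+ y ] r     = refl
compareTree-correct zero     1+[2 y ] r     = refl
compareTree-correct 2[1+ x ] zero     false = compareTree-correct x zero false
compareTree-correct 2[1+ x ] zero     true  = compareTree-correct x zero false
compareTree-correct 1+[2 x ] zero     false = compareTree-correct x zero false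
compareTree-correct 1+[2 x ] zero     true  = compareTree-correct x zero false
compareTree-correct 2[1+ x ] 2[1+ y ] r     = trans
  (compareTree-correct x y (carry false false r)) (sym (carry-correct-22 (toℕ x) (toℕ y) r))
compareTree-correct 2[1+ x ] 1+[2 y ] r     = trans
  (compareTree-correct x y (carry false true r)) (sym (carry-correct-21 (toℕ x) (toℕ y) r))
compareTree-correct 1+[2 x ] 2[1+ y ] r     = trans
  (compareTree-correct x y (carry true false r)) (sym (carry-correct-12 (toℕ x) (toℕ y) r))
compareTree-correct 1+[2 x ] 1+[2 y ] r     = trans
  (compareTree-correct x y (carry true true r)) (sym (carry-correct-11 (toℕ x) (toℕ y) r))

-- For a positive denominator d = 1 + 2 b or d = 2 + 2 b, the tail of its
-- numeral is b, and d ≤ 2 m is equivalent to b < m.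
atLeastHalf : Tree → Bool
atLeastHalf q = not (isCons (head (head q))) ∧ compareTree (tail (head q) , false) (tail (tail q))

atLeastHalfᴾ : {q : I → Tree} → Polytime inp q → Polytime inp (encodeBool ∘ atLeastHalf ∘ q)
atLeastHalfᴾ Q = notᴾ (isConsᴾ (headᴾ (headᴾ Q))) ∧ᴾ compareᴾ (tailᴾ (tailᴾ Q)) (tailᴾ (headᴾ Q))

-- The product is written `m * 2` because cross multiplication in `½ ≤? q` leaves it in that form.
tail<ᵇ : ∀ d m → compareTree (encodeℕ m , false) (tail (encodeℕ (suc d))) ≡ (suc d <ᵇ suc (m * 2))
tail<ᵇ d m = trans (half (fromℕ (suc d)) (toℕ-fromℕ (suc d)))
  (cong (λ k → suc d <ᵇ suc k) (*-comm 2 m))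
  where
  -- `fromℕ (suc d)` does not expose its least significant digit, so an arbitrary numeral of the
  -- same value is analysed.
  half : ∀ x → toℕ x ≡ suc d →
    compareTree (encodeℕ m , false) (tail (encodeℕᵇ x)) ≡ (suc d <ᵇ suc (2 * m))
  half 2[1+ x ] eq = trans (compareTree-correct x (fromℕ m) false) (trans
    (cong (toℕ x <ᵇ_) (trans (+-identityʳ _) (toℕ-fromℕ m)))
    (trans (sym (even<ᵇodd (suc (toℕ x)) m)) (cong (_<ᵇ suc (2 * m)) eq)))
  half 1+[2 x ] eq = trans (compareTree-correct x (fromℕ m) false) (trans
    (cong (toℕ x <ᵇ_) (trans (+-identityʳ _) (toℕ-fromℕ m)))
    (trans (sym (even<ᵇeven (toℕ x) m)) (cong (_<ᵇ suc (2 * m)) eq)))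

atLeastHalf-encodeℚ : ∀ q → atLeastHalf (encodeℚ q) ≡ does (½ ℚ.≤? q)
atLeastHalf-encodeℚ (mkℚ (+ zero) d _)  = tail<ᵇ d 0
atLeastHalf-encodeℚ (mkℚ (+ suc m) d _) = trans (tail<ᵇ d (suc m))
  (cong (_<ᵇ suc (suc (m * 2))) (sym (+-identityʳ d)))
atLeastHalf-encodeℚ (mkℚ -[1+ m ] d _) = refl

-- Masked lists and matrices

encodeList-cong : {f g : A → Tree} (xs : List A) → (∀ {x} → x ∈ xs → f x ≡ g x) →
  encodeList f xs ≡ encodeList g xs
encodeList-cong []       f≡g = refl
encodeList-cong (x ∷ xs) f≡g = cong₂ _∙_ (f≡g (here refl)) (encodeList-cong xs (f≡g ∘ there))

length≤size : (e : A → Tree) (xs : List A) → length xs ≤ size (encodeList e xs)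
length≤size e []       = z≤n
length≤size e (x ∷ xs) = s≤s (≤-trans (length≤size e xs) (m≤n+m _ (size (e x))))

spine-encodeList : (e : A → Tree) (xs : List A) → spine (encodeList e xs) ≡ length xs
spine-encodeList e []       = refl
spine-encodeList e (x ∷ xs) = cong suc (spine-encodeList e xs)

-- Each entry costs at most 3 for its bit and 1 for the pairing node. A new mask is thus bounded
-- without reference to the old one, which yields the growth bounds for pruning and for rounding.
size-mask≤ : (μ : A → Bool) (xs : List A) →
  size (encodeList (encodeBool ∘ μ) xs) ≤ 1 + length xs * 4
size-mask≤ μ []       = ≤-refl
size-mask≤ μ (x ∷ xs) = s≤s (≤-trans (+-mono-≤ (size-encodeBool≤3 (μ x)) (size-mask≤ μ xs)) ≤-refl)

mapTree : (Tree → Tree) → Tree → Tree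
mapTree = gather (λ _ → true)

mapTree-encodeList : {g : Tree → Tree} {e e′ : A → Tree} → (∀ x → g (e x) ≡ e′ x) →
  ∀ xs → mapTree g (encodeList e xs) ≡ encodeList e′ xs
mapTree-encodeList g≡e′ []       = refl
mapTree-encodeList g≡e′ (x ∷ xs) = cong₂ _∙_ (g≡e′ x) (mapTree-encodeList g≡e′ xs)

unmasked : (Tree → Tree) → Tree → Tree → Tree
unmasked g mask l = gather (not ∘ isCons ∘ tail) (g ∘ head) (zipTree l mask)

unmasked-encodeList : {g : Tree → Tree} {e e′ : A → Tree} (μ : A → Bool) →
  (∀ x → g (e x) ≡ e′ x) → ∀ xs →
  unmasked g (encodeList (encodeBool ∘ μ) xs) (encodeList e xs) ≡
  encodeList e′ (filterᵇ (not ∘ μ) xs)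
unmasked-encodeList {g = g} {e} μ g≡e′ xs
  rewrite zipTree-encodeList e (encodeBool ∘ μ) xs =
  gather-encodeList (not ∘ isCons ∘ tail) (g ∘ head)
    (λ x → cong not (isCons-encodeBool (μ x))) g≡e′ xs

-- `g` receives the mask because the rows of a matrix have to be thinned by the same mask as the
-- list of rows.
unmaskedᴾ : {mask l : I → Tree} {g : Tree → Tree → Tree} →
  Polytime {I = Tree × Tree} (λ (m , x) → m ∙ x) (λ (m , x) → g m x) →
  Polytime inp mask → Polytime inp l →
  Polytime inp (λ i → unmasked (g (mask i)) (mask i) (l i))
unmaskedᴾ {mask = mask} G M L = gatherᴾ M
  (notᴾ (isConsᴾ (tailᴾ (tailᴾ varᴾ))))
  (seqᴾ (headᴾ varᴾ ∙ᴾ headᴾ (tailᴾ varᴾ)) (reindex (λ (i , x) → mask i , head x) G))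
  (zipᴾ L M)

submatrix : Tree → Tree → Tree
submatrix mask = unmasked (unmasked (λ x → x) mask) mask

submatrix-encodeList : {e : A → A → Tree} (μ : A → Bool) (xs : List A) →
  submatrix (encodeList (encodeBool ∘ μ) xs) (encodeList (λ x → encodeList (e x) xs) xs) ≡
  encodeList (λ x → encodeList (e x) (filterᵇ (not ∘ μ) xs)) (filterᵇ (not ∘ μ) xs)
submatrix-encodeList μ xs =
  unmasked-encodeList {g = unmasked (λ x → x) _} μ
    (λ x → unmasked-encodeList {g = λ x → x} μ (λ _ → refl) xs) xs

submatrixᴾ : {mask m : I → Tree} → Polytime inp mask → Polytime inp m →
  Polytime inp (λ i → submatrix (mask i) (m i))
submatrixᴾ = unmaskedᴾ {g = λ mask → unmasked (λ x → x) mask}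
  (unmaskedᴾ {g = λ _ x → x} (tailᴾ varᴾ) (headᴾ varᴾ) (tailᴾ varᴾ))

-- Cycle detection

atLeastTwo : List A → Bool
atLeastTwo (_ ∷ _ ∷ _) = true
atLeastTwo _           = false

isCons-tail : (e : A → Tree) (xs : List A) → isCons (tail (encodeList e xs)) ≡ atLeastTwo xs
isCons-tail e []          = refl
isCons-tail e (_ ∷ [])    = refl
isCons-tail e (_ ∷ _ ∷ _) = refl

isCons-encodeList : (e : A → Tree) (xs : List A) → isCons (encodeList e xs) ≡ not (null xs)
isCons-encodeList e []      = refl
isCons-encodeList e (_ ∷ _) = refl

-- μ marks the vertices pruned so far.
module Prune {A : Set} (adj : A → A → Bool) (vs : List A) where

  neighbours : (A → Bool) → A → List A
  neighbours μ u = filterᵇ (λ v → adj u v ∧ not (μ v)) vs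

  prune : (A → Bool) → A → Bool
  prune μ u = μ u ∨ not (atLeastTwo (neighbours μ u))

  -- Only the length of the encoded mask matters: it supplies one round per entry of `vs`, and the
  -- program already holds this tree.
  pruneAll : (A → Bool) → A → Bool
  pruneAll μ = foldTree (λ _ → prune) μ (encodeList (encodeBool ∘ μ) vs)

  survivors : (A → Bool) → List A
  survivors μ = filterᵇ (not ∘ pruneAll μ) vs

liveEntry : Tree → Bool
liveEntry t = isCons (head t) ∧ not (isCons (tail t))

pruneRow : Tree → Tree → Tree
pruneRow mask t = encodeBool
  (isCons (tail t) ∨ not (isCons (tail (gather liveEntry (λ x → x) (zipTree (head t) mask)))))

pruneTree : Tree → Tree → Tree
pruneTree mask m = mapTree (pruneRow mask) (zipTree m mask)

pruneTree-encodeList : (adj : A → A → Bool) (vs : List A) (μ : A → Bool) →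
  pruneTree (encodeList (encodeBool ∘ μ) vs)
            (encodeList (λ u → encodeList (encodeBool ∘ adj u) vs) vs) ≡
  encodeList (encodeBool ∘ Prune.prune adj vs μ) vs
pruneTree-encodeList adj vs μ
  rewrite zipTree-encodeList (λ u → encodeList (encodeBool ∘ adj u) vs) (encodeBool ∘ μ) vs =
  mapTree-encodeList row vs
  where
  open Prune adj vs
  row : ∀ u → pruneRow (encodeList (encodeBool ∘ μ) vs)
                (encodeList (encodeBool ∘ adj u) vs ∙ encodeBool (μ u)) ≡
              encodeBool (prune μ u)
  row u rewrite zipTree-encodeList (encodeBool ∘ adj u) (encodeBool ∘ μ) vs =
    cong encodeBool (cong₂ _∨_ (isCons-encodeBool (μ u)) (cong not (trans
      (cong (isCons ∘ tail) (gather-encodeList liveEntry (λ x → x)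
        (λ v → cong₂ (λ a b → a ∧ not b) (isCons-encodeBool (adj u v)) (isCons-encodeBool (μ v)))
        (λ _ → refl) vs))
      (isCons-tail _ (neighbours μ u)))))

pruneTreeᴾ : {mask m : I → Tree} → Polytime inp mask → Polytime inp m →
  Polytime inp (λ i → pruneTree (mask i) (m i))
pruneTreeᴾ M L = gatherᴾ M (nilᴾ ∙ᴾ nilᴾ)
  (isConsᴾ (tailᴾ (tailᴾ varᴾ)) ∨ᴾ
   notᴾ (isConsᴾ (tailᴾ (gatherᴾ nilᴾ
     (isConsᴾ (headᴾ (tailᴾ varᴾ)) ∧ᴾ notᴾ (isConsᴾ (tailᴾ (tailᴾ varᴾ))))
     (tailᴾ varᴾ)
     (zipᴾ (headᴾ (tailᴾ varᴾ)) (headᴾ varᴾ))))))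
  (zipᴾ L M)

AdjacencyMatrix : Set
AdjacencyMatrix = Σ[ n ∈ ℕ ] ((Fin n → Fin n → Bool) × List (Fin n))

Mask : AdjacencyMatrix → Set
Mask (n , _ , _) = Fin n → Bool

encodeMatrix : AdjacencyMatrix → Tree
encodeMatrix (n , adj , vs) = encodeList (λ u → encodeList (encodeBool ∘ adj u) vs) vs

encodeMask : ∀ i → Mask i → Tree
encodeMask (n , adj , vs) μ = encodeList (encodeBool ∘ μ) vs

pruneStep : ∀ i → Tree → Mask i → Mask i
pruneStep (n , adj , vs) _ = Prune.prune adj vs

survivorsᴾ : Polytime {I = Σ[ i ∈ AdjacencyMatrix ] Mask i}
  (λ (i , μ) → encodeMatrix i ∙ encodeMask i μ)
  (λ ((n , adj , vs) , μ) → encodeBool (not (null (Prune.survivors adj vs μ))))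
survivorsᴾ = castᴾ
  (λ ((n , adj , vs) , μ) → let open Prune adj vs in cong encodeBool (trans
    (cong isCons (gather-encodeList (not ∘ isCons) (λ x → x)
      (λ u → cong not (isCons-encodeBool (pruneAll μ u))) (λ _ → refl) vs))
    (isCons-encodeList (encodeBool ∘ pruneAll μ) (survivors μ))))
  (isConsᴾ (gatherᴾ nilᴾ (notᴾ (isConsᴾ (tailᴾ varᴾ))) (tailᴾ varᴾ)
    (foldᴾ (headᴾ varᴾ) (tailᴾ varᴾ) (tailᴾ varᴾ))))
  where
  -- The starting mask belongs to the index, since `foldᴾ` takes the initial state as a function of
  -- the index.
  Start = Σ[ i ∈ AdjacencyMatrix ] Mask i
  round : ∀ (j : Start) → Tree → Mask (proj₁ j) → Mask (proj₁ j)
  round = pruneStep ∘ proj₁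
  grow : ∀ ((i , _) : Start) x μ → size (encodeMask i (pruneStep i x μ)) ≤
    size (encodeMask i μ) + (1 + size (encodeMatrix i ∙ x) * 4)
  grow (i@(n , adj , vs) , _) x μ = ≤-trans (size-mask≤ (pruneStep i x μ) vs)
    (≤-trans (s≤s (*-monoˡ-≤ 4 (≤-trans (length≤size _ vs) (size-hd≤ (encodeMatrix i) x))))
             (m≤n+m _ (size (encodeMask i μ))))
  Step : Polytime {I = Σ[ j ∈ Start ] (Tree × Mask (proj₁ j))}
    (λ ((i , _) , x , μ) → encodeMatrix i ∙ x ∙ encodeMask i μ)
    (λ ((i , _) , x , μ) → encodeMask i (pruneStep i x μ))
  Step = castᴾ (λ (((n , adj , vs) , _) , _ , μ) → pruneTree-encodeList adj vs μ)
    (pruneTreeᴾ (tailᴾ (tailᴾ varᴾ)) (headᴾ varᴾ))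
  open Fold {I = Start} {S = Mask ∘ proj₁} {c = encodeMatrix ∘ proj₁} (encodeMask ∘ proj₁) round
    (con 1 ⊕ X ⊗ con 4) grow Step

-- Correctness of pruning

∈-filterᵇ⁺ : (p : A → Bool) {x : A} {xs : List A} → x ∈ xs → p x ≡ true → x ∈ filterᵇ p xs
∈-filterᵇ⁺ p x∈xs px = ∈-filter⁺ (T? ∘ p) x∈xs (Equivalence.from T-≡ px)

∈-filterᵇ⁻ : (p : A → Bool) {x : A} {xs : List A} → x ∈ filterᵇ p xs → x ∈ xs × p x ≡ true
∈-filterᵇ⁻ p x∈ = map₂ (Equivalence.to T-≡) (∈-filter⁻ (T? ∘ p) x∈)

∧≡true⁻ : ∀ {a b} → a ∧ b ≡ true → a ≡ true × b ≡ true
∧≡true⁻ {true} {true} refl = refl , refl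

∨≡false⁻ : ∀ {a b} → a ∨ b ≡ false → a ≡ false × b ≡ false
∨≡false⁻ {false} {false} refl = refl , refl

not≡true⁻ : ∀ {a} → not a ≡ true → a ≡ false
not≡true⁻ {false} refl = refl

atLeastTwo⁺ : {x y : A} {xs : List A} → x ∈ xs → y ∈ xs → x ≢ y → atLeastTwo xs ≡ true
atLeastTwo⁺ {xs = _ ∷ _ ∷ _} _ _ _ = refl
atLeastTwo⁺ {xs = _ ∷ []} (here refl) (here refl) x≢y = contradiction refl x≢y

atLeastTwo⁻ : {xs : List A} → Unique xs → atLeastTwo xs ≡ true →
  Σ[ x ∈ A ] Σ[ y ∈ A ] (x ∈ xs × y ∈ xs × x ≢ y)
atLeastTwo⁻ {xs = x ∷ y ∷ _} ((x≢y ∷ _) ∷ _) _ = x , y , here refl , there (here refl) , x≢y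

nonempty⁺ : {x : A} {xs : List A} → x ∈ xs → not (null xs) ≡ true
nonempty⁺ {xs = _ ∷ _} _ = refl

nonempty⁻ : {xs : List A} → not (null xs) ≡ true → Σ[ x ∈ A ] x ∈ xs
nonempty⁻ {xs = x ∷ _} _ = x , here refl

lookup-injective : {xs : List A} → Unique xs → ∀ {i j} → lookup xs i ≡ lookup xs j → i ≡ j
lookup-injective (_ ∷ _)    {zero}  {zero}  eq = refl
lookup-injective (x∉xs ∷ _) {zero}  {suc j} eq =
  contradiction eq (All.lookup x∉xs (∈-lookup j))
lookup-injective (x∉xs ∷ _) {suc i} {zero}  eq =
  contradiction (sym eq) (All.lookup x∉xs (∈-lookup i))
lookup-injective (_ ∷ xs!)  {suc i} {suc j} eq = cong suc (lookup-injective xs! eq)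

unique⇒length≤ : {xs : List (Fin n)} → Unique xs → length xs ≤ n
unique⇒length≤ xs! = injective⇒≤ (lookup-injective xs!)

module PruneProperties {A : Set} (adj : A → A → Bool) (vs : List A) where
  open Prune adj vs

  prune-false : ∀ {μ u v w} → μ u ≡ false →
    v ∈ vs → adj u v ≡ true → μ v ≡ false →
    w ∈ vs → adj u w ≡ true → μ w ≡ false → v ≢ w →
    prune μ u ≡ false
  prune-false {μ} {u} {v} {w} μu v∈ uv μv w∈ uw μw v≢w = cong₂ _∨_ μu (cong not
    (atLeastTwo⁺ (∈-filterᵇ⁺ _ v∈ (cong₂ (λ a b → a ∧ not b) uv μv))
                 (∈-filterᵇ⁺ _ w∈ (cong₂ (λ a b → a ∧ not b) uw μw)) v≢w))

  prunes : (A → Bool) → Tree → A → Bool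
  prunes = foldTree (λ _ → prune)

  prunes-reflects-false : ∀ μ l {u} → prunes μ l u ≡ false → μ u ≡ false
  prunes-reflects-false μ nil     eq = eq
  prunes-reflects-false μ (x ∙ l) eq = proj₁ (∨≡false⁻ (prunes-reflects-false (prune μ) l eq))

  unpruned : (A → Bool) → List A
  unpruned μ = filterᵇ (not ∘ μ) vs

  filterᵇ-cong : {p q : A → Bool} (xs : List A) → (∀ {x} → x ∈ xs → p x ≡ q x) →
    filterᵇ p xs ≡ filterᵇ q xs
  filterᵇ-cong []       p≡q = refl
  filterᵇ-cong {p} {q} (x ∷ xs) p≡q with p x | q x | p≡q (here refl)
  ... | false | false | refl = filterᵇ-cong xs (p≡q ∘ there)
  ... | true  | true  | refl = cong (x ∷_) (filterᵇ-cong xs (p≡q ∘ there))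

  Stable : (A → Bool) → Set
  Stable μ = ∀ {u} → u ∈ vs → prune μ u ≡ μ u

  -- On `vs`, a round depends on a mask only through its values on `vs`.
  prune-stable : ∀ {μ} → Stable μ → Stable (prune μ)
  prune-stable {μ} stable {u} u∈ = cong₂ (λ b xs → b ∨ not (atLeastTwo xs)) (stable u∈)
    (filterᵇ-cong vs (λ {v} v∈ → cong (λ b → adj u v ∧ not b) (stable v∈)))

  prunes-stable : ∀ {μ} l → Stable μ → Stable (prunes μ l)
  prunes-stable nil     stable = stable
  prunes-stable (x ∙ l) stable = prunes-stable l (prune-stable stable)

  -- Marks are never cleared, so any change lowers the count. For the induction only the counted
  -- vertices are restricted to `xs`; `neighbours` still ranges over all of `vs`.
  progress : ∀ μ xs →
    (∀ {u} → u ∈ xs → prune μ u ≡ μ u) ⊎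
    length (filterᵇ (not ∘ prune μ) xs) < length (filterᵇ (not ∘ μ) xs)
  progress μ [] = inj₁ λ ()
  progress μ (x ∷ xs) with μ x in μx | atLeastTwo (neighbours μ x) in two | progress μ xs
  ... | true  | _     | inj₂ lt = inj₂ lt
  ... | false | true  | inj₂ lt = inj₂ (s≤s lt)
  ... | false | false | inj₂ lt = inj₂ (m≤n⇒m≤1+n lt)
  ... | true  | _     | inj₁ stable = inj₁ λ where
    (here refl) → trans (cong (_∨ not (atLeastTwo (neighbours μ x))) μx) (sym μx)
    (there u∈)  → stable u∈
  ... | false | true  | inj₁ stable = inj₁ λ where
    (here refl) → trans (cong₂ (λ a b → a ∨ not b) μx two) (sym μx)
    (there u∈)  → stable u∈
  -- Here `x` itself becomes marked while nothing changes behind it, so the count drops by exactly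
  -- one.
  ... | false | false | inj₁ stable =
    inj₂ (s≤s (≤-reflexive (cong length (filterᵇ-cong xs (cong not ∘ stable)))))

  -- Every round before stabilisation uses one item of `l` and marks at least one vertex; a stable
  -- mask stays stable for the remaining items.
  prunes-reach-stable : ∀ μ l → length (unpruned μ) ≤ spine l → Stable (prunes μ l)
  prunes-reach-stable μ l ≤l with progress μ vs
  ... | inj₁ stable = prunes-stable l stable
  prunes-reach-stable μ nil     ≤l | inj₂ lt = contradiction (≤-trans lt ≤l) λ ()
  prunes-reach-stable μ (x ∙ l) ≤l | inj₂ lt =
    prunes-reach-stable (prune μ) l (s≤s⁻¹ (≤-trans lt ≤l))

  pruneAll-stable : ∀ μ → Stable (pruneAll μ)
  pruneAll-stable μ = prunes-reach-stable μ _
    (≤-trans (length-filter (T? ∘ not ∘ μ) vs)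
             (≤-reflexive (sym (spine-encodeList (encodeBool ∘ μ) vs))))

-- Neighbours on a cycle and the closing of a path

module Cycles {A : Set} (_~_ : Rel A 0ℓ) (~-sym : Symmetric _~_) where

  last-neighbour : ∀ y ys z → Linked _~_ ((y ∷ ys) ∷ʳ z) → Σ[ w ∈ A ] (w ∈ y ∷ ys × w ~ z)
  last-neighbour y []        z (y~z ∷ _) = y , here refl , y~z
  last-neighbour y (y′ ∷ ys) z (_ ∷ path) with last-neighbour y′ ys z path
  ... | w , w∈ , w~z = w , there w∈ , w~z

  -- On a cycle `x` and `z` coincide, and a single inner vertex would have the same vertex on both
  -- sides; the disjunction excludes this. After one step the left end is an inner vertex and hence
  -- differs from `z`.
  inner-neighbours : ∀ x ys z → Linked _~_ ((x ∷ ys) ∷ʳ z) → Unique (x ∷ ys) → z ∉ ys →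
    x ≢ z ⊎ 2 ≤ length ys → ∀ {w} → w ∈ ys →
    Σ[ a ∈ A ] Σ[ b ∈ A ] (a ∈ (x ∷ ys) ∷ʳ z × b ∈ (x ∷ ys) ∷ʳ z × w ~ a × w ~ b × a ≢ b)
  inner-neighbours x (y ∷ []) z (x~y ∷ y~z ∷ _) _ _ (inj₁ x≢z) (here refl) =
    x , z , here refl , there (there (here refl)) , ~-sym x~y , y~z , x≢z
  inner-neighbours x (y ∷ []) z _ _ _ (inj₂ (s≤s ())) _
  inner-neighbours x (y ∷ y′ ∷ ys) z (x~y ∷ y~y′ ∷ _) ((_ ∷ x≢y′ ∷ _) ∷ _) _ _ (here refl) =
    x , y′ , here refl , there (there (here refl)) , ~-sym x~y , y~y′ , x≢y′
  inner-neighbours x (y ∷ ys@(_ ∷ _)) z (_ ∷ path) (_ ∷ ys!) z∉ _ (there w∈)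
    with inner-neighbours y ys z path ys! (z∉ ∘ there) (inj₁ (z∉ ∘ here ∘ sym)) w∈
  ... | a , b , a∈ , b∈ , rest = a , b , there a∈ , there b∈ , rest

  cycle-neighbours : ∀ u ws → Unique (u ∷ ws) → 3 ≤ length (u ∷ ws) →
    Linked _~_ ((u ∷ ws) ∷ʳ u) → ∀ {w} → w ∈ u ∷ ws →
    Σ[ a ∈ A ] Σ[ b ∈ A ] (a ∈ (u ∷ ws) ∷ʳ u × b ∈ (u ∷ ws) ∷ʳ u × w ~ a × w ~ b × a ≢ b)
  -- The neighbours of `u` are the first and the last of the other vertices; they differ because the
  -- last one lies in `w₂ ∷ ws`, which omits `w₁`.
  cycle-neighbours u (w₁ ∷ w₂ ∷ ws) (_ ∷ w₁∉ ∷ _) _ (u~w₁ ∷ _ ∷ path) (here refl)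
    with last-neighbour w₂ ws u path
  ... | b , b∈ , b~u =
    w₁ , b , there (here refl) , there (there (∈-++⁺ˡ b∈)) , u~w₁ , ~-sym b~u , All.lookup w₁∉ b∈
  cycle-neighbours u ws uws!@(u∉ ∷ _) (s≤s 2≤) path (there w∈) =
    inner-neighbours u ws u path uws! (λ u∈ → All.lookup u∉ u∈ refl) (inj₂ 2≤) w∈
  cycle-neighbours u (_ ∷ []) _ (s≤s (s≤s ())) _ _

  -- The path is cut off at `z`, with `k` its position in `xs`. The length bound counts `x` and `z`;
  -- putting `y` in front then gives a cycle of at least three vertices.
  closeAt : ∀ {x xs z y} → Linked _~_ (x ∷ xs) → z ∈ xs → z ~ y →
    Σ[ k ∈ ℕ ] (Linked _~_ ((x ∷ take (suc k) xs) ∷ʳ y) × 2 ≤ length (x ∷ take (suc k) xs))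
  closeAt (x~z ∷ _) (here refl) z~y = 0 , x~z ∷ z~y ∷ [-] , ≤-refl
  closeAt (x~w ∷ path) (there z∈) z~y with closeAt path z∈ z~y
  ... | k , closed , 2≤ = suc k , x~w ∷ closed , m≤n⇒m≤1+n 2≤

-- A path among vertices with two live neighbours each is extended at its head
-- until the next vertex repeats.
module FindCycle (H : Graph n) (Live : Fin n → Set) where
  open Graph H
  open Cycles _~_ ~-sym
  open DecMembership (_≟_ {n}) using () renaming (_∈?_ to _∈ᴸ?_)

  TwoLive : Fin n → Set
  TwoLive u = Σ[ a ∈ Fin n ] Σ[ b ∈ Fin n ] (Live a × Live b × u ~ a × u ~ b × a ≢ b)

  -- A path without repetition has at most `n` vertices, whereas exhausted fuel would mean more than
  -- `n`.
  extend : (∀ {u} → Live u → TwoLive u) → ∀ fuel x xs → n ≤ length xs + fuel →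
    Unique (x ∷ xs) → Linked _~_ (x ∷ xs) → Live x → HasCycle H
  extend two zero x xs n≤ xxs! path live = contradiction
    (≤-trans (unique⇒length≤ xxs!) (≤-trans n≤ (≤-reflexive (+-identityʳ (length xs))))) 1+n≰n
  extend two (suc fuel) x [] n≤ xxs! path live with two live
  ... | a , _ , liveₐ , _ , x~a , _ =
    extend two fuel a (x ∷ []) n≤
      (((λ eq → ~-irrefl (sym eq) x~a) ∷ []) ∷ xxs!) (~-sym x~a ∷ path) liveₐ
  extend two (suc fuel) x xs@(w ∷ ws) n≤ xxs! path@(_ ∷ path′) live = continue avoid
    where
    -- Of two distinct neighbours one is not the predecessor `w`. If it repeats, it lies at least
    -- two steps back on the path, so the cycle closed there is long enough.
    avoid : Σ[ z ∈ Fin n ] (Live z × x ~ z × z ≢ w)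
    avoid with two live
    ... | a , b , liveₐ , live_b , x~a , x~b , a≢b with a ≟ w
    ...   | no a≢w   = a , liveₐ , x~a , a≢w
    ...   | yes refl = b , live_b , x~b , a≢b ∘ sym
    continue : Σ[ z ∈ Fin n ] (Live z × x ~ z × z ≢ w) → HasCycle H
    continue (z , live′ , x~z , z≢w) with z ∈ᴸ? (x ∷ xs)
    ... | no z∉ = extend two fuel z (x ∷ xs)
      (≤-trans n≤ (≤-reflexive (+-suc (length xs) fuel)))
      (¬Any⇒All¬ (x ∷ xs) z∉ ∷ xxs!) (~-sym x~z ∷ path) live′
    ... | yes (here refl)         = contradiction x~z (~-irrefl refl)
    ... | yes (there (here refl)) = contradiction refl z≢w
    ... | yes (there (there z∈)) with path | closeAt path′ z∈ (~-sym x~z)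
    ...   | x~w ∷ _ | k , closed , 2≤ =
      x , take (suc (suc k)) xs , Unique.take⁺ (suc (suc (suc k))) xxs! , s≤s 2≤ , x~w ∷ closed

-- Iterative rounding

open Graph

does-true⁻ : (a? : Dec A) → does a? ≡ true → A
does-true⁻ (yes a) refl = a

does-false⁻ : (a? : Dec A) → does a? ≡ false → ¬ A
does-false⁻ (no ¬a) refl = ¬a

mask : Subset n → Fin n → Bool
mask R u = does (u ∈? R)

adjacency : Graph n → Fin n → Fin n → Bool
adjacency G u v = does (_~?_ G u v)

vertices : Graph n → List (Fin n)
vertices G = elements (V G)

∈-elements⁺ : {S : Subset n} {u : Fin n} → u Subset.∈ S → u ∈ elements S
∈-elements⁺ {S = S} {u} u∈S = ∈-filter⁺ (_∈? S) (∈-allFin u) u∈S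

∈-elements⁻ : {S : Subset n} {u : Fin n} → u ∈ elements S → u Subset.∈ S
∈-elements⁻ {n} {S} u∈ = proj₂ (∈-filter⁻ (_∈? S) {xs = allFin n} u∈)

elements-unique : (S : Subset n) → Unique (elements S)
elements-unique {n} S = Unique.filter⁺ (_∈? S) (Unique.allFin⁺ n)

x∈p─q⇒x∉q : ∀ (p q : Subset n) {u} → u Subset.∈ p ─ q → u Subset.∉ q
x∈p─q⇒x∉q (_ ∷ p) (outside ∷ q) (there u∈) (there u∈q) = x∈p─q⇒x∉q p q u∈ u∈q
x∈p─q⇒x∉q (_ ∷ p) (inside  ∷ q) (there u∈) (there u∈q) = x∈p─q⇒x∉q p q u∈ u∈q

x∈p─q⁻ : ∀ {p q : Subset n} {u} → u Subset.∈ p ─ q → u Subset.∈ p × u Subset.∉ q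
x∈p─q⁻ {p = p} {q} u∈ = p─q⊆p p q u∈ , x∈p─q⇒x∉q p q u∈

elements-─ : (S R : Subset n) → elements (S ─ R) ≡ filterᵇ (not ∘ mask R) (elements S)
elements-─ {n} S R = go (allFin n)
  where
  go : ∀ us → filter (_∈? (S ─ R)) us ≡ filterᵇ (not ∘ mask R) (filter (_∈? S) us)
  go [] = refl
  go (u ∷ us) with does (u ∈? (S ─ R)) | does (u ∈? S)
    | does-⇔ (mk⇔ x∈p─q⁻ (λ (u∈S , u∉R) → x∈p∧x∉q⇒x∈p─q u∈S u∉R))
        (u ∈? (S ─ R)) ((u ∈? S) ×-dec ¬? (u ∈? R))
  ... | _ | false | refl = go us
  ... | _ | true  | refl with does (u ∈? R)
  ...   | false = cong (u ∷_) (go us)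
  ...   | true  = go us

∈large⁺ : (H : Graph n) (x : Fin n → ℚ) {u : Fin n} → u Subset.∈ V H → ½ ℚ.≤ x u →
  u Subset.∈ large H x
∈large⁺ H x {u} u∈V ½≤ = lookup⇒[]= u _ (trans (lookup∘tabulate _ u)
  (dec-true ((u ∈? V H) ×-dec (½ ℚ.≤? x u)) (u∈V , ½≤)))

∈large⁻ : (H : Graph n) (x : Fin n → ℚ) {u : Fin n} → u Subset.∈ large H x →
  u Subset.∈ V H × ½ ℚ.≤ x u
∈large⁻ H x {u} u∈ = does-true⁻ ((u ∈? V H) ×-dec (½ ℚ.≤? x u))
  (trans (sym (lookup∘tabulate _ u)) ([]=⇒lookup u∈))

-- H = G ∖ R up to extensional equality of the edge relation.
record IsResidual (G H : Graph n) (R : Subset n) : Set where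
  field
    V≡    : V H ≡ V G ─ R
    edge⁻ : ∀ {u v} → _~_ H u v → _~_ G u v × u Subset.∉ R × v Subset.∉ R
    edge⁺ : ∀ {u v} → _~_ G u v → u Subset.∉ R → v Subset.∉ R → _~_ H u v

residual-⊥ : (G : Graph n) → IsResidual G G ⊥
residual-⊥ G = record
  { V≡    = sym (p─⊥≡p (V G))
  ; edge⁻ = λ e → e , ∉⊥ , ∉⊥
  ; edge⁺ = λ e _ _ → e
  }

residual-∖ : {G H : Graph n} {R : Subset n} (A : Subset n) →
  IsResidual G H R → IsResidual G (H ∖ A) (R ∪ A)
residual-∖ {G = G} {R = R} A res = record
  { V≡    = trans (cong (_─ A) V≡) (p─q─r≡p─q∪r (V G) R A)
  ; edge⁻ = λ (e , u∉A , v∉A) → let (e′ , u∉R , v∉R) = edge⁻ e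
                                in e′ , ∉-∪ u∉R u∉A , ∉-∪ v∉R v∉A
  ; edge⁺ = λ e u∉ v∉ → edge⁺ e (u∉ ∘ x∈p∪q⁺ ∘ inj₁) (v∉ ∘ x∈p∪q⁺ ∘ inj₁) ,
                        u∉ ∘ x∈p∪q⁺ ∘ inj₂ , v∉ ∘ x∈p∪q⁺ ∘ inj₂
  }
  where
  open IsResidual res
  ∉-∪ : ∀ {u} → u Subset.∉ R → u Subset.∉ A → u Subset.∉ R ∪ A
  ∉-∪ u∉R u∉A u∈ with x∈p∪q⁻ R A u∈
  ... | inj₁ u∈R = u∉R u∈R
  ... | inj₂ u∈A = u∉A u∈A

-- The test runs on the matrix of `G`, with the vertices of `R` counted as pruned from the outset.
survives : Graph n → Subset n → Bool
survives G R = not (null (Prune.survivors (adjacency G) (vertices G) (mask R)))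

module ResidualProperties {G H : Graph n} {R : Subset n} (res : IsResidual G H R) where
  open IsResidual res

  V⊆ : ∀ {u} → u Subset.∈ V H → u Subset.∈ V G
  V⊆ {u} u∈ = proj₁ (x∈p─q⁻ (subst (u Subset.∈_) V≡ u∈))

  unmasked-vertices : filterᵇ (not ∘ mask R) (vertices G) ≡ vertices H
  unmasked-vertices = trans (sym (elements-─ (V G) R)) (cong elements (sym V≡))

  ∈vertices⇒∉R : ∀ {u} → u ∈ vertices H → u Subset.∉ R
  ∈vertices⇒∉R {u} u∈ = proj₂ (x∈p─q⁻ (subst (u Subset.∈_) V≡ (∈-elements⁻ u∈)))

  submatrix-correct : submatrix (encodeSubset G R) (encodeGraph G) ≡ encodeGraph H
  submatrix-correct = trans (submatrix-encodeList (mask R) (vertices G)) (trans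
    (cong (λ us → encodeList (λ u → encodeList (λ v → encodeBool (adjacency G u v)) us) us)
          unmasked-vertices)
    -- Adjacency in `G` and in `H` is known to agree only off `R`, so the entries are compared for
    -- listed vertices only.
    (encodeList-cong (vertices H) λ u∈ → encodeList-cong (vertices H) λ v∈ →
      cong encodeBool (does-⇔
        (mk⇔ (λ e → edge⁺ e (∈vertices⇒∉R u∈) (∈vertices⇒∉R v∈)) (proj₁ ∘ edge⁻))
        (_~?_ G _ _) (_~?_ H _ _))))

  unmasked-correct : (c : Fin n → ℚ) →
    unmasked (λ x → x) (encodeSubset G R) (encodeVector G c) ≡ encodeVector H c
  unmasked-correct c = trans (unmasked-encodeList {g = λ x → x} (mask R) (λ _ → refl) (vertices G))
    (cong (encodeList (encodeℚ ∘ c)) unmasked-vertices)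

  fill-correct : (x : Fin n → ℚ) →
    fill (encodeSubset G R) (mapTree (encodeBool ∘ atLeastHalf) (encodeVector H x)) ≡
    encodeSubset G (R ∪ large H x)
  fill-correct x = trans
    (cong (fill (encodeSubset G R)) (trans
      (mapTree-encodeList (cong encodeBool ∘ atLeastHalf-encodeℚ ∘ x) (vertices H))
      (cong (encodeList (λ u → encodeBool (does (½ ℚ.≤? x u)))) (sym unmasked-vertices))))
    (trans (fill-encodeList (mask R) (λ u → does (½ ℚ.≤? x u)) (vertices G))
      (encodeList-cong (vertices G) λ {u} u∈ → cong encodeBool
        (does-⇔ (mk⇔ (to u∈) from) ((u ∈? R) ⊎-dec (½ ℚ.≤? x u)) (u ∈? (R ∪ large H x)))))
    where
    to : ∀ {u} → u ∈ vertices G → u Subset.∈ R ⊎ ½ ℚ.≤ x u → u Subset.∈ R ∪ large H x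
    to {u} u∈ (inj₁ u∈R) = x∈p∪q⁺ (inj₁ u∈R)
    -- For `u` in `R` the value `x u` is arbitrary, but the union contains `u` anyway; otherwise `u`
    -- is a vertex of `H` and the threshold puts it into `large H x`.
    to {u} u∈ (inj₂ ½≤)  with u ∈? R
    ... | yes u∈R = x∈p∪q⁺ (inj₁ u∈R)
    ... | no  u∉R = x∈p∪q⁺ (inj₂ (∈large⁺ H x
      (subst (u Subset.∈_) (sym V≡) (x∈p∧x∉q⇒x∈p─q (∈-elements⁻ u∈) u∉R)) ½≤))
    from : ∀ {u} → u Subset.∈ R ∪ large H x → u Subset.∈ R ⊎ ½ ℚ.≤ x u
    from u∈ with x∈p∪q⁻ R (large H x) u∈
    ... | inj₁ u∈R = inj₁ u∈R
    ... | inj₂ u∈A = inj₂ (proj₂ (∈large⁻ H x u∈A))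

  open Prune (adjacency G) (vertices G)
  open PruneProperties (adjacency G) (vertices G)

  cycle⇒survives : HasCycle H → survives G R ≡ true
  cycle⇒survives (u , ws , uws! , 3≤ , cycle) = nonempty⁺ (∈-filterᵇ⁺ _
    (∈-elements⁺ (proj₁ (on-cycle (here refl))))
    (cong not (spared (encodeSubset G R) (λ w∈ → dec-false (_ ∈? R) (proj₂ (on-cycle w∈)))
      (here refl))))
    where
    open Cycles (_~_ H) (~-sym H)
    uncycle : ∀ {w} → w ∈ (u ∷ ws) ∷ʳ u → w ∈ u ∷ ws
    uncycle w∈ with ∈-++⁻ (u ∷ ws) w∈
    ... | inj₁ w∈′         = w∈′
    ... | inj₂ (here refl) = here refl
    on-cycle : ∀ {w} → w ∈ (u ∷ ws) ∷ʳ u → w Subset.∈ V G × w Subset.∉ R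
    on-cycle w∈ =
      let (_ , _ , _ , _ , w~a , _) = cycle-neighbours u ws uws! 3≤ cycle (uncycle w∈)
          (e , w∉R , _) = edge⁻ w~a
      in ~⇒∈V G e , w∉R
    -- The invariant speaks of the whole cycle at once, since each of its vertices is protected by
    -- two others of the same cycle.
    spared : ∀ {μ} l → (∀ {w} → w ∈ (u ∷ ws) ∷ʳ u → μ w ≡ false) →
      ∀ {w} → w ∈ (u ∷ ws) ∷ʳ u → prunes μ l w ≡ false
    spared nil     μ-false w∈ = μ-false w∈
    spared (_ ∙ l) μ-false = spared l λ w∈ →
      let (a , b , a∈ , b∈ , w~a , w~b , a≢b) =
            cycle-neighbours u ws uws! 3≤ cycle (uncycle w∈)
      in prune-false (μ-false w∈)
           (∈-elements⁺ (proj₁ (on-cycle a∈)))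
           (dec-true (_~?_ G _ a) (proj₁ (edge⁻ w~a))) (μ-false a∈)
           (∈-elements⁺ (proj₁ (on-cycle b∈)))
           (dec-true (_~?_ G _ b) (proj₁ (edge⁻ w~b))) (μ-false b∈)
           a≢b

  -- Marks are never cleared, so survivors lie outside `R`, and edges of `G` between them are edges
  -- of `H`. The search starts from a one-vertex path with fuel `n`.
  survives⇒cycle : survives G R ≡ true → HasCycle H
  survives⇒cycle eq with nonempty⁻ eq
  ... | u , u∈ with ∈-filterᵇ⁻ (not ∘ pruneAll (mask R)) u∈
  ...   | u∈vs , alive =
    extend two n u [] ≤-refl ([] ∷ []) [-] (u∈vs , not≡true⁻ alive)
    where
    Live : Fin n → Set
    Live w = w ∈ vertices G × pruneAll (mask R) w ≡ false
    open FindCycle H Live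
    ∉R : ∀ {w} → Live w → w Subset.∉ R
    ∉R {w} (_ , pruned) = does-false⁻ (w ∈? R)
      (prunes-reflects-false (mask R) (encodeSubset G R) pruned)
    two : ∀ {w} → Live w → TwoLive w
    -- By stability the final mask is its own pruning on the vertices, so an unmarked vertex has
    -- passed the neighbour test against that very mask.
    two {w} live@(w∈ , pruned)
      with atLeastTwo⁻ (Unique.filter⁺ _ (elements-unique (V G)))
             (not≡false⁻ (proj₂ (∨≡false⁻ (trans (pruneAll-stable (mask R) w∈) pruned))))
      where
      not≡false⁻ : ∀ {b} → not b ≡ false → b ≡ true
      not≡false⁻ {true} refl = refl
    ... | a , b , a∈ , b∈ , a≢b with ∈-filterᵇ⁻ _ a∈ | ∈-filterᵇ⁻ _ b∈
    ...   | a∈vs , wa | b∈vs , wb with ∧≡true⁻ wa | ∧≡true⁻ wb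
    ...     | w~a , a-alive | w~b , b-alive =
      let liveₐ = a∈vs , not≡true⁻ a-alive
          live_b = b∈vs , not≡true⁻ b-alive
      in a , b , liveₐ , live_b ,
         edge⁺ (does-true⁻ (_~?_ G w a) w~a) (∉R live) (∉R liveₐ) ,
         edge⁺ (does-true⁻ (_~?_ G w b) w~b) (∉R live) (∉R live_b) , a≢b

elements-─-< : (S A : Subset n) {u : Fin n} → u Subset.∈ S → u Subset.∈ A →
  length (elements (S ─ A)) < length (elements S)
elements-─-< S A {u} u∈S u∈A = ≤-trans
  (≤-reflexive (cong (suc ∘ length) (elements-─ S A)))
  (filter-notAll (T? ∘ not ∘ mask A) (elements S) (Any.map masked (∈-elements⁺ u∈S)))
  where
  masked : ∀ {v} → u ≡ v → ¬ T (not (mask A v))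
  masked refl rewrite dec-true (u ∈? A) u∈A = λ ()

-- The rounding loop as a program

module _ (pw : Prog) (produces : IsProduceWitness pw) where

  Instance : Set₁
  Instance = Σ[ n ∈ ℕ ] Σ[ G ∈ Graph n ] Σ[ c ∈ (Fin n → ℚ) ] NonNegative G c

  CyclicInstance : Set₁
  CyclicInstance = Σ[ (_ , G , _) ∈ Instance ] HasCycle G

  input : Instance → Tree
  input (n , G , c , _) = encodeInput G c

  witnessSpec : ∀ (((n , H , c , _) , _) : CyclicInstance) → Σ[ x ∈ (Fin n → ℚ) ] Σ[ t ∈ ℕ ]
    (pw ⊢ encodeInput H c ⇓ encodeVector H x ⟨ t ⟩ ×
     t ≤ proj₁ produces * size (encodeInput H c) ^ proj₁ (proj₂ produces) × IsWitness H c x)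
  witnessSpec ((n , H , c , c≥0) , cyclic) = proj₂ (proj₂ produces) H c c≥0 cyclic

  witness : (((n , _) , _) : CyclicInstance) → Fin n → ℚ
  witness i = proj₁ (witnessSpec i)

  witnessᴾ : Polytime {I = CyclicInstance} (input ∘ proj₁)
    (λ i@((_ , H , _) , _) → encodeVector H (witness i))
  witnessᴾ = polytime pw (con a ⊗ X^ k) λ i →
    let (_ , t , returns , t≤ , _) = witnessSpec i
    in t , returns , ≤-trans t≤ (≤-reflexive (cong (a *_) (sym (⟦X^⟧ k _))))
    where
    a = proj₁ produces
    k = proj₁ (proj₂ produces)

  -- `H` and the proof accompany `R` so that the run can be matched with `Rounding` and `pw` can be
  -- applied; only `R` is encoded.
  Stage : Instance → Set₁
  Stage (n , G , _) = Σ[ H ∈ Graph n ] Σ[ R ∈ Subset n ] IsResidual G H R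

  removed : ∀ i → Stage i → Subset (proj₁ i)
  removed i (_ , R , _) = R

  encodeStage : ∀ i → Stage i → Tree
  encodeStage i@(n , G , _) s = encodeSubset G (removed i s)

  continues : ∀ i → Stage i → Bool
  continues (n , G , _) (_ , R , _) = survives G R

  cyclicInstance : ∀ i (s : Stage i) → continues i s ≡ true → CyclicInstance
  cyclicInstance (n , G , c , c≥0) (H , R , res) eq =
    (n , H , c , λ u u∈ → c≥0 u (V⊆ u∈)) , survives⇒cycle eq
    where open ResidualProperties res

  roundStage : ∀ i (s : Stage i) → continues i s ≡ true → Stage i
  roundStage i s@(H , R , res) eq =
    H ∖ large H x , R ∪ large H x , residual-∖ (large H x) res
    where x = witness (cyclicInstance i s eq)

  -- The Boolean and its equation are separate arguments: a round needs the equation as evidence of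
  -- a cycle, while proofs must split on the Boolean.
  nextWith : ∀ i (s : Stage i) b → continues i s ≡ b → Stage i
  nextWith i s true  eq = roundStage i s eq
  nextWith i s false eq = s

  next : ∀ i → Tree → Stage i → Stage i
  next i _ s = nextWith i s (continues i s) refl

  -- The witness may depend on the evidence of a cycle, so two proofs of the same equation have to
  -- be identified.
  nextWith-true : ∀ i s b (eq : continues i s ≡ b) (eq′ : continues i s ≡ true) →
    nextWith i s b eq ≡ roundStage i s eq′
  nextWith-true i s true  eq eq′ = cong (roundStage i s) (≡-irrelevant eq eq′)
  nextWith-true i s false eq eq′ = contradiction (trans (sym eq) eq′) λ ()

  nextWith-false : ∀ i s b (eq : continues i s ≡ b) → continues i s ≡ false →
    nextWith i s b eq ≡ s
  nextWith-false i s false eq eq′ = refl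
  nextWith-false i s true  eq eq′ = contradiction (trans (sym eq) eq′) λ ()

  nextᴾ : Polytime {I = Σ[ i ∈ Instance ] (Tree × Stage i)}
    (λ (i , t , s) → input i ∙ t ∙ encodeStage i s)
    (λ (i , t , s) → encodeStage i (next i t s))
  nextᴾ = branchᴾ (λ (i , _ , s) → continues i s)
    (λ (i , _ , s) → isCons-encodeBool (continues i s))
    (seqᴾ (headᴾ (headᴾ varᴾ) ∙ᴾ tailᴾ (tailᴾ varᴾ))
      (reindex (λ ((n , G , _) , _ , (_ , R , _)) → (n , adjacency G , vertices G) , mask R)
        survivorsᴾ))
    (castᴾ
      (λ ((i , _ , s@(H , R , res)) , eq) → trans
        (ResidualProperties.fill-correct res (witness (cyclicInstance i s eq)))
        (cong (encodeStage i) (sym (nextWith-true i s _ refl eq))))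
      -- The returned vector is reduced to threshold bits over the vertices of `H` at once; `fill`
      -- spreads them over those of `G`.
      (fillᴾ (tailᴾ (tailᴾ varᴾ))
        (gatherᴾ nilᴾ (nilᴾ ∙ᴾ nilᴾ) (atLeastHalfᴾ (tailᴾ varᴾ))
          (seqᴾ
            (castᴾ
              (λ (((_ , _ , c , _) , _ , (_ , _ , res)) , _) → let open ResidualProperties res in
                cong₂ _∙_ submatrix-correct (unmasked-correct c))
              (submatrixᴾ (tailᴾ (tailᴾ varᴾ)) (headᴾ (headᴾ varᴾ)) ∙ᴾ
               unmaskedᴾ {g = λ _ x → x} (tailᴾ varᴾ) (tailᴾ (tailᴾ varᴾ)) (tailᴾ (headᴾ varᴾ))))
            (reindex (λ ((i , _ , s) , eq) → cyclicInstance i s eq) witnessᴾ)))))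
    (castᴾ
      (λ ((i , _ , s) , eq) → cong (encodeStage i) (sym (nextWith-false i s _ refl eq)))
      (tailᴾ (tailᴾ varᴾ)))

  initial : ∀ i → Stage i
  initial (n , G , _) = G , ⊥ , residual-⊥ G

  -- The cost vector serves as a counter: it has one entry per vertex of `G`, and `next` ignores
  -- what the entries are.
  final : ∀ i → Stage i
  final i@(n , G , c , _) = foldTree (next i) (initial i) (encodeVector G c)

  abstract
    finalᴾ : Polytime {I = Instance} input (λ i → encodeStage i (final i))
    finalᴾ = foldᴾ varᴾ (tailᴾ varᴾ) (castᴾ
      -- Replacing every cost by `nil`, the code of `false`, produces the mask of the empty set.
      (λ (n , G , c , _) → mapTree-encodeList
        (λ u → cong encodeBool (sym (dec-false (u ∈? ⊥) ∉⊥))) (vertices G))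
      (gatherᴾ {g = λ _ _ → nil} nilᴾ (nilᴾ ∙ᴾ nilᴾ) nilᴾ (tailᴾ varᴾ)))
      where
      grow : ∀ i t s → size (encodeStage i (next i t s)) ≤
        size (encodeStage i s) + (1 + size (input i ∙ t) * 4)
      grow i@(n , G , c , _) t s = ≤-trans (size-mask≤ (mask (removed i (next i t s))) (vertices G))
        (≤-trans (s≤s (*-monoˡ-≤ 4 (≤-trans (length≤size (encodeℚ ∘ c) (vertices G))
                   (≤-trans (size-tl≤ (encodeGraph G) _) (size-hd≤ (input i) t)))))
                 (m≤n+m _ (size (encodeStage i s))))
      open Fold {I = Instance} {S = Stage} {c = input} encodeStage next
        (con 1 ⊕ X ⊗ con 4) grow nextᴾ

  module _ (i : Instance) where
    private
      c = proj₁ (proj₂ (proj₂ i))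

    Rounds : Stage i → Stage i → Set₁
    Rounds s@(H , _) s′ = Rounding pw c H (removed i s) (removed i s′)

    -- Once the cycle test fails the stage no longer changes, so the remaining items are idle.
    rounds-stop : ∀ l s → continues i s ≡ false → Rounds s (foldTree (next i) s l)
    rounds-stop nil s@(_ , _ , res) eq = stop λ cyclic → contradiction
      (trans (sym (ResidualProperties.cycle⇒survives res cyclic)) eq) λ ()
    rounds-stop (t ∙ l) s eq rewrite nextWith-false i s _ refl eq = rounds-stop l s eq

    -- An entry of at least ½ removes a vertex, so each active round uses one item and at least one
    -- vertex. With no items left there are no vertices, hence no cycle.
    rounds : ∀ l s → length (vertices (proj₁ s)) ≤ spine l → Rounds s (foldTree (next i) s l)
    rounds nil s@(H , _) ≤l = stop λ where
      (u , [] , _ , s≤s () , _)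
      (u , _ ∷ _ , _ , _ , u~w ∷ _) → contradiction
        (≤-trans (∈-length (∈-elements⁺ (~⇒∈V H u~w))) ≤l) λ ()
    rounds (t ∙ l) s@(H , R , _) ≤l = go (continues i s) refl
      where
      go : ∀ b eq → Rounds s (foldTree (next i) (nextWith i s b eq) l)
      go false eq = rounds-stop l s eq
      go true  eq =
        let cyc = cyclicInstance i s eq
            (x , t , returns , _ , isWitness) = witnessSpec cyc
            (u , u∈V , ½≤) = IsWitness.has-half isWitness
            smaller = elements-─-< (V H) (large H x) u∈V (∈large⁺ H x u∈V ½≤)
        in step x (proj₂ cyc) (t , returns)
             (rounds l (roundStage i s eq) (s≤s⁻¹ (≤-trans smaller ≤l)))

lemma20 : (pw : Prog) → IsProduceWitness pw →
    Σ[ alg ∈ Prog ] Σ[ a ∈ ℕ ] Σ[ k ∈ ℕ ]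
    (∀ {n : ℕ} (G : Graph n) (c : Fin n → ℚ) → NonNegative G c →
    Σ[ R ∈ Subset n ] Σ[ t ∈ ℕ ]
    (Rounding pw c G ⊥ R ×
    alg ⊢ encodeInput G c ⇓ encodeSubset G R ⟨ t ⟩ ×
    t ≤ a * size (encodeInput G c) ^ k))
lemma20 pw produces =
  let (a , k , bounded) = monomial-bound (Polytime.bound P)
  in Polytime.program P , a , k , λ {n} G c c≥0 →
    let i             = n , G , c , c≥0
        (t , run , t≤) = Polytime.run P i
    in removed pw produces i (final pw produces i) , t ,
       rounds pw produces i (encodeVector G c) (initial pw produces i)
         (≤-reflexive (sym (spine-encodeList (encodeℚ ∘ c) (vertices G)))) ,
       run , ≤-trans t≤ (bounded _ (1≤size (encodeInput G c)))
  where P = finalᴾ pw produces
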